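{- Let $r \ge 2$ be an integer and $\mathbf{m} = [m_2, m_3, \ldots]$ a type. Let $\mathbf{S} = \sum_{\mathbf{n} \ge 0} C_{\mathbf{n}} \mathbf{t}^{\mathbf{n}}$, where $C_{\mathbf{n}}$ is the number of subdigons of type $\mathbf{n}$, and let $C^{(r)}_{\mathbf{m}} = [\mathbf{t}^{\mathbf{m}}]\mathbf{S}^r$. Then $C^{(r)}_{\mathbf{m}}$ equals the number of subdigons of type $\mathbf{m} + \vec{r}$ whose central polygon is an $(r+1)$-gon, where $\vec{r}$ is the type with $1$ in position $r$ (i.e. $m_r$ increased by one) and $0$ elsewhere.
   Context: A type is a vector $\mathbf{m} = [m_2, m_3, \ldots]$ of nonnegative integers with finitely many nonzero entries; $\mathbf{t}^{\mathbf{m}} = \prod_{k\ge2} t_k^{m_k}$ in formal power series in $t_2, t_3, \ldots$. Let $V_{\mathbf{m}} = 2 + \sum_{k\ge2}(k-1)m_k$. A subdigon of type $\mathbf{m}$ is a subdivision of a fixed convex polygon with $V_{\mathbf{m}}$ labeled vertices, one of whose sides is distinguished as the roof, by pairwise non-crossing diagonals into exactly $m_k$ faces that are $(k+1)$-gons for each $k \ge 2$ (two subdigons are the same iff they use the same set of diagonals); for the zero type the unique subdigon is the null subdigon, a single edge. The central polygon of a non-null subdigon is the face having the roof as a side. -}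

module Defs where

open import Data.Nat using (ℕ; zero; suc; _+_; _*_; _∸_; _≡ᵇ_; _<ᵇ_)
open import Data.Bool using (Bool; true; false; _∧_; _∨_; not; if_then_else_)
open import Data.List using (List; []; _∷_; _++_; [_]; map; concatMap; length; upTo; filterᵇ; replicate; zipWith; reverse)
open import Data.Bool.ListAction using (all; any)
open import Data.Nat.ListAction using (sum)
open import Data.Product using (_×_; _,_)

-- A type m = [m_2, m_3, ...] is a finite list; entry i is m_{i+2}.
-- Entries beyond the list are 0 (so lists differing by trailing zeros denote the same type).
Ty : Set
Ty = List ℕ

private
  vsum : ℕ → Ty → ℕ
  vsum k [] = 0
  vsum k (x ∷ xs) = k * x + vsum (suc k) xs

Vt : Ty → ℕ
Vt m = 2 + vsum 1 m

_⊕_ : Ty → Ty → Ty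
[] ⊕ ys = ys
(x ∷ xs) ⊕ [] = x ∷ xs
(x ∷ xs) ⊕ (y ∷ ys) = (x + y) ∷ (xs ⊕ ys)

unitTy : ℕ → Ty
unitTy r = replicate (r ∸ 2) 0 ++ [ 1 ]

private
  dropZ : List ℕ → List ℕ
  dropZ [] = []
  dropZ (zero ∷ xs) = dropZ xs
  dropZ (suc x ∷ xs) = suc x ∷ xs

  eqL : List ℕ → List ℕ → Bool
  eqL [] [] = true
  eqL (x ∷ xs) (y ∷ ys) = (x ≡ᵇ y) ∧ eqL xs ys
  eqL _ _ = false

normTy : Ty → Ty
normTy m = reverse (dropZ (reverse m))

sameTy : Ty → Ty → Bool
sameTy a b = eqL (normTy a) (normTy b)

isZeroTy : Ty → Bool
isZeroTy m = all (λ x → x ≡ᵇ 0) m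

-- Polygon with vertices 0,1,…,V-1 in cyclic order; the roof is the side {0, V-1}.
-- Segments are pairs (i , j) with i < j.

Seg : Set
Seg = ℕ × ℕ

eqSeg : Seg → Seg → Bool
eqSeg (a , b) (c , d) = (a ≡ᵇ c) ∧ (b ≡ᵇ d)

elemℕ : ℕ → List ℕ → Bool
elemℕ x = any (λ y → x ≡ᵇ y)

elemSeg : Seg → List Seg → Bool
elemSeg s = any (eqSeg s)

subs : {A : Set} → List A → List (List A)
subs [] = [] ∷ []
subs (x ∷ xs) = let r = subs xs in map (x ∷_) r ++ r

pairs : {A : Set} → List A → List (A × A)
pairs [] = []
pairs (x ∷ xs) = map (x ,_) xs ++ pairs xs

isSide : ℕ → Seg → Bool
isSide V (i , j) = (j ≡ᵇ suc i) ∨ ((i ≡ᵇ 0) ∧ (j ≡ᵇ V ∸ 1))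

isDiagonal : ℕ → Seg → Bool
isDiagonal V (i , j) = (suc i <ᵇ j) ∧ (j <ᵇ V) ∧ not ((i ≡ᵇ 0) ∧ (j ≡ᵇ V ∸ 1))

allDiagonals : ℕ → List Seg
allDiagonals V = filterᵇ (isDiagonal V) (concatMap (λ i → map (i ,_) (upTo V)) (upTo V))

crosses : Seg → Seg → Bool
crosses (a , b) (c , d) = ((a <ᵇ c) ∧ (c <ᵇ b) ∧ (b <ᵇ d)) ∨ ((c <ᵇ a) ∧ (a <ᵇ d) ∧ (d <ᵇ b))

nonCrossing : List Seg → Bool
nonCrossing D = all (λ { (s , t) → not (crosses s t) }) (pairs D)

isEdge : ℕ → List Seg → Seg → Bool
isEdge V D s = isSide V s ∨ elemSeg s D

private
  lastOr : ℕ → List ℕ → ℕ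
  lastOr d [] = d
  lastOr d (x ∷ xs) = lastOr x xs

  consec : List ℕ → List Seg
  consec [] = []
  consec (x ∷ []) = []
  consec (x ∷ y ∷ ys) = (x , y) ∷ consec (y ∷ ys)

cycPairs : List ℕ → List Seg
cycPairs [] = []
cycPairs (x ∷ xs) = consec (x ∷ xs) ++ [ (x , lastOr x xs) ]

-- An increasing vertex list S spans a face of the subdivision (by diagonals D)
-- iff |S| ≥ 3, every cyclically consecutive pair of S is an edge, and no
-- non-consecutive pair of S is an edge (no edge runs through its interior).
isFace : ℕ → List Seg → List ℕ → Bool
isFace V D S = (2 <ᵇ length S) ∧ all (λ p → (isEdge V D p ∧ elemSeg p (cycPairs S)) ∨ (not (isEdge V D p) ∧ not (elemSeg p (cycPairs S)))) (pairs S)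

faces : ℕ → List Seg → List (List ℕ)
faces V D = filterᵇ (isFace V D) (subs (upTo V))

typeOf : ℕ → List Seg → Ty
typeOf V D = map (λ k → length (filterᵇ (λ S → length S ≡ᵇ suc k) (faces V D))) (map (2 +_) (upTo (V ∸ 1)))

subdigons : Ty → List (List Seg)
subdigons m = filterᵇ (λ D → nonCrossing D ∧ sameTy (typeOf (Vt m) D) m) (subs (allDiagonals (Vt m)))

C : Ty → ℕ
C m = length (subdigons m)

-- the central polygon (face containing the roof {0, V-1}) is an (r+1)-gon
centralIs : ℕ → ℕ → List Seg → Bool
centralIs r V D = any (λ S → elemℕ 0 S ∧ elemℕ (V ∸ 1) S ∧ (length S ≡ᵇ suc r)) (faces V D)

below : Ty → List Ty
below [] = [] ∷ []
below (x ∷ xs) = concatMap (λ i → map (i ∷_) (below xs)) (upTo (suc x))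

coeffSPow : ℕ → Ty → ℕ
coeffSPow zero m = if isZeroTy m then 1 else 0
coeffSPow (suc r) m = sum (map (λ n → C n * coeffSPow r (zipWith _∸_ m n)) (below m))

countCentral : ℕ → Ty → ℕ
countCentral r m = length (filterᵇ (centralIs r (Vt m)) (subdigons m))

{-# OPTIONS --safe #-}
module Submission where

-- A set of pairwise non-crossing chords over the vertices 0, …, N has an outer path from 0 to N, and
-- its faces are the polygons lying under that path.  Call it a system with r outer edges.  Subdigons are
-- the systems with one outer edge, the roof.  Deleting the roof of a subdigon with a central
-- (r + 1)-gon leaves a system with r outer edges and removes exactly that face; and cutting a system
-- at the first vertex of its outer path splits off a subdigon and divides the faces between
-- the two parts, which is the recursion S ^ (r + 1) = S · S ^ r.  Euler's relation
-- N = r + Σ (|face| − 2) shows that the number of vertices is determined by the type.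

open import Defs
open import Data.Bool using (Bool; true; false; T; _∧_; _∨_; not; if_then_else_)
open import Data.Bool.ListAction using (all)
open import Data.Bool.Properties using (T-≡; T?; T-∧; ∨-identityʳ; ∨-zeroʳ; ∧-identityʳ; ∧-zeroʳ; ¬-not; not-¬)
open import Data.Empty using (⊥-elim)
open import Data.List using (List; []; _∷_; [_]; _++_; _∷ʳ_; map; concatMap; length; upTo; applyUpTo; filterᵇ; reverse; replicate; zipWith; cartesianProduct; cartesianProductWith)
open import Data.List.Membership.Propositional using (_∈_; _∉_; find; lose)
open import Data.List.Membership.Propositional.Properties
open import Data.List.Membership.Propositional.Properties.WithK using (unique∧set⇒bag)
open import Data.List.Properties using (length-map; length-++; length-upTo; ∷-injectiveʳ; map-++; map-injective; filter-++; reverse-++; unfold-reverse; reverse-involutive)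
open import Data.List.Relation.Binary.BagAndSetEquality using (∼bag⇒↭)
open import Data.List.Relation.Binary.Permutation.Propositional using (_↭_)
open import Data.List.Relation.Binary.Permutation.Propositional.Properties as Perm using (↭-length)
open import Data.List.Relation.Binary.Pointwise using (Pointwise; []; _∷_)
open import Data.List.Relation.Unary.All as All using (All; []; _∷_)
open import Data.List.Relation.Unary.All.Properties using (all⁺; all⁻)
open import Data.List.Relation.Unary.AllPairs as AllPairs using (AllPairs; []; _∷_)
import Data.List.Relation.Unary.AllPairs.Properties as AllPairs
open import Data.List.Relation.Unary.Any as Any using (here; there)
open import Data.List.Relation.Unary.Any.Properties using (any⁺; any⁻)
open import Data.List.Relation.Unary.Unique.Propositional using (Unique)
import Data.List.Relation.Unary.Unique.Propositional.Properties as Unique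
open import Data.List.Reverse using (Reverse; []; _∶_∶ʳ_; reverseView)
open import Data.Nat
open import Data.Nat.Induction using (<-rec)
open import Data.Nat.ListAction using (sum)
open import Data.Nat.ListAction.Properties using (sum-↭; sum-++)
open import Data.Nat.Properties
open import Data.Product using (∃-syntax; _×_; _,_; proj₁; proj₂)
open import Data.Sum as Sum using (_⊎_; inj₁; inj₂)
open import Data.Unit using (⊤; tt)
open import Function using (_∘_; id)
open import Function.Bundles using (mk⇔; Equivalence)
open import Relation.Binary.Definitions using (tri<; tri≈; tri>)
open import Relation.Binary.PropositionalEquality hiding ([_])
open import Relation.Nullary using (¬_; yes; no)

-- Lists of chords are an awkward carrier for these operations: cutting translates vertices, gluing
-- merges lists, and a resulting list has the right elements long before it has the order of the
-- enumeration. All geometry is therefore done on Boolean edge predicates, compared only on pairs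
-- `i < j` with `j ≤ N`, and filtering a fixed enumeration turns a predicate back into a list.
-- Bijections are given as relations, so no inverse function on lists has to be computed. A second
-- obstacle is that `isEdge` always contains the roof, so deleting it cannot be expressed there.
-- Systems use `edge`, where the roof has to be listed as a chord (unless it is a side), and where
-- it is absent as soon as the outer path has two steps. Systems also leave `N` free, which lets
-- them be cut and glued without bookkeeping of sizes; Euler's relation serves to return to
-- subdigons, whose number of vertices is prescribed.

private variable
  A B I : Set

-- Boolean reflection and filtered lists

T⇒≡ : ∀ {b} → T b → b ≡ true
T⇒≡ = Equivalence.to T-≡

≡⇒T : ∀ {b} → b ≡ true → T b
≡⇒T = Equivalence.from T-≡

∈-filterᵇ⁺ : ∀ (p : A → Bool) {x xs} → x ∈ xs → p x ≡ true → x ∈ filterᵇ p xs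
∈-filterᵇ⁺ p x∈ px = ∈-filter⁺ (T? ∘ p) x∈ (≡⇒T px)

∈-filterᵇ⁻ : ∀ (p : A → Bool) {x xs} → x ∈ filterᵇ p xs → x ∈ xs × p x ≡ true
∈-filterᵇ⁻ p x∈ with ∈-filter⁻ (T? ∘ p) x∈
... | x∈xs , px = x∈xs , T⇒≡ px

unique-filterᵇ : ∀ (p : A → Bool) {xs} → Unique xs → Unique (filterᵇ p xs)
unique-filterᵇ p = Unique.filter⁺ (T? ∘ p)

sameElements⇒↭ : {xs ys : List A} → Unique xs → Unique ys →
  (∀ {x} → x ∈ xs → x ∈ ys) → (∀ {x} → x ∈ ys → x ∈ xs) → xs ↭ ys
sameElements⇒↭ u v f g = ∼bag⇒↭ (unique∧set⇒bag u v (mk⇔ f g))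

-- Cardinality of predicates

record Card (P : A → Set) (n : ℕ) : Set where
  constructor card
  field
    elements : List A
    unique   : Unique elements
    sound    : ∀ {x} → x ∈ elements → P x
    complete : ∀ {x} → P x → x ∈ elements
    size     : length elements ≡ n

card-functional : {P : A → Set} {m n : ℕ} → Card P m → Card P n → m ≡ n
card-functional (card xs u s c refl) (card ys u′ s′ c′ refl) =
  ↭-length (sameElements⇒↭ u u′ (c′ ∘ s) (c ∘ s′))

card-filterᵇ : ∀ (p : A → Bool) {xs} → Unique xs →
  Card (λ x → x ∈ xs × p x ≡ true) (length (filterᵇ p xs))
card-filterᵇ p {xs} u = card (filterᵇ p xs) (unique-filterᵇ p u) (∈-filterᵇ⁻ p)
  (λ (x∈ , px) → ∈-filterᵇ⁺ p x∈ px) refl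

card-⇔ : {P Q : A → Set} {n : ℕ} → (∀ {x} → P x → Q x) → (∀ {x} → Q x → P x) → Card P n → Card Q n
card-⇔ f g (card xs u s c e) = card xs u (f ∘ s) (c ∘ g) e

-- The correspondence is a relation because images are known only up to agreement of edge
-- predicates: each direction picks some witness, and uniqueness is checked separately by
-- extensionality of chord lists.
module _ {P : A → Set} {Q : B → Set} (R : A → B → Set)
  (to   : ∀ {x} → P x → ∃[ y ] Q y × R x y)
  (from : ∀ {y} → Q y → ∃[ x ] P x × R x y)
  (injective  : ∀ x x′ y → P x → P x′ → R x y → R x′ y → x ≡ x′)
  (functional : ∀ x y y′ → Q y → Q y′ → R x y → R x y′ → y ≡ y′)
  where

  private
    Matched : A → B → Set
    Matched x y = P x × Q y × R x y

    images : ∀ {xs} → All P xs → ∃[ ys ] Pointwise Matched xs ys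
    images [] = [] , []
    images (px ∷ pxs) with to px | images pxs
    ... | y , qy , r | ys , ms = y ∷ ys , (px , qy , r) ∷ ms

    matched⁻ : ∀ {xs ys y} → Pointwise Matched xs ys → y ∈ ys → ∃[ x ] x ∈ xs × Matched x y
    matched⁻ (m ∷ _) (here refl) = _ , here refl , m
    matched⁻ (_ ∷ ms) (there y∈) with matched⁻ ms y∈
    ... | x , x∈ , m = x , there x∈ , m

    matched⁺ : ∀ {xs ys x} → Pointwise Matched xs ys → x ∈ xs → ∃[ y ] y ∈ ys × Matched x y
    matched⁺ (m ∷ _) (here refl) = _ , here refl , m
    matched⁺ (_ ∷ ms) (there x∈) with matched⁺ ms x∈
    ... | y , y∈ , m = y , there y∈ , m

    images-unique : ∀ {xs ys} → Unique xs → Pointwise Matched xs ys → Unique ys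
    images-unique [] [] = []
    images-unique (x∉ ∷ u) ((px , _ , r) ∷ ms) = All.tabulate distinct ∷ images-unique u ms
      where
      distinct : ∀ {y} → y ∈ _ → _ ≢ y
      distinct y∈ refl with matched⁻ ms y∈
      ... | x′ , x′∈ , px′ , _ , r′ = All.lookup x∉ x′∈ (injective _ _ _ px px′ r r′)

    images-length : ∀ {xs ys} → Pointwise Matched xs ys → length ys ≡ length xs
    images-length [] = refl
    images-length (_ ∷ ms) = cong suc (images-length ms)

  card-bijection : ∀ {n} → Card P n → Card Q n
  card-bijection (card xs u s c e) with images (All.tabulate {xs = xs} s)
  ... | ys , ms = card ys (images-unique u ms) (λ y∈ → proj₁ (proj₂ (proj₂ (proj₂ (matched⁻ ms y∈)))))
                    complete (trans (images-length ms) e)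
    where
    complete : ∀ {y} → Q y → y ∈ ys
    complete qy with from qy
    ... | x , px , r with matched⁺ ms (c px)
    ... | y′ , y′∈ , _ , qy′ , r′ = subst (_∈ ys) (functional _ _ _ qy′ qy r′ r) y′∈

length-cartesianProduct : (xs : List A) (ys : List B) → length (cartesianProduct xs ys) ≡ length xs * length ys
length-cartesianProduct [] ys = refl
length-cartesianProduct (x ∷ xs) ys = trans (length-++ (map (x ,_) ys))
  (cong₂ _+_ (length-map (x ,_) ys) (length-cartesianProduct xs ys))

card-× : {P : A → Set} {Q : B → Set} {m n : ℕ} → Card P m → Card Q n →
  Card (λ ((x , y) : A × B) → P x × Q y) (m * n)
card-× (card xs u s c refl) (card ys u′ s′ c′ refl) =
  card (cartesianProduct xs ys) (Unique.cartesianProduct⁺ u u′)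
    (λ xy∈ → let x∈ , y∈ = ∈-cartesianProduct⁻ xs ys xy∈ in s x∈ , s′ y∈)
    (λ (px , qy) → ∈-cartesianProduct⁺ (c px) (c′ qy))
    (length-cartesianProduct xs ys)

card-Σ : {P : I → A → Set} (f : I → ℕ) (is : List I) → Unique is → (∀ {i} → i ∈ is → Card (P i) (f i)) →
  Card (λ ((i , x) : I × A) → i ∈ is × P i x) (sum (map f is))
card-Σ f [] _ _ = card [] [] (λ ()) (λ ()) refl
card-Σ {P = P} f (i ∷ is) (i∉ ∷ u) cs with cs (here refl) | card-Σ {P = P} f is u (cs ∘ there)
... | card xs ux sx cx ex | card ys uy sy cy ey = card (map (i ,_) xs ++ ys)
  (Unique.++⁺ (Unique.map⁺ (λ { refl → refl }) ux) uy disjoint) sound complete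
  (trans (length-++ (map (i ,_) xs)) (cong₂ _+_ (trans (length-map (i ,_) xs) ex) ey))
  where
  disjoint : ∀ {z} → ¬ (z ∈ map (i ,_) xs × z ∈ ys)
  disjoint (z∈ , z∈′) with ∈-map⁻ (i ,_) z∈
  ... | x , _ , refl = All.lookup i∉ (proj₁ (sy z∈′)) refl
  sound : ∀ {z} → z ∈ map (i ,_) xs ++ ys → _
  sound z∈ with ∈-++⁻ (map (i ,_) xs) z∈
  ... | inj₂ z∈ys = there (proj₁ (sy z∈ys)) , proj₂ (sy z∈ys)
  ... | inj₁ z∈xs with ∈-map⁻ (i ,_) z∈xs
  ... | x , x∈ , refl = here refl , sx x∈
  complete : ∀ {z} → _ → z ∈ map (i ,_) xs ++ ys
  complete (here refl , p) = ∈-++⁺ˡ (∈-map⁺ (i ,_) (cx p))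
  complete (there j∈ , p) = ∈-++⁺ʳ (map (i ,_) xs) (cy (j∈ , p))

-- Sublists as subsets

module _ {A : Set} where

  subs-⊆ : ∀ {xs ys : List A} {x} → ys ∈ subs xs → x ∈ ys → x ∈ xs
  subs-⊆ {[]} (here refl) ()
  subs-⊆ {z ∷ xs} ys∈ x∈ with ∈-++⁻ (map (z ∷_) (subs xs)) ys∈
  ... | inj₂ ys∈′ = there (subs-⊆ ys∈′ x∈)
  ... | inj₁ ys∈′ with ∈-map⁻ (z ∷_) ys∈′
  ... | zs , zs∈ , refl with x∈
  ... | here refl = here refl
  ... | there x∈zs = there (subs-⊆ zs∈ x∈zs)

  unique-subs : ∀ {xs : List A} → Unique xs → Unique (subs xs)
  unique-subs {[]} _ = [] ∷ []
  unique-subs {x ∷ xs} (x∉ ∷ u) = Unique.++⁺ (Unique.map⁺ ∷-injectiveʳ (unique-subs u)) (unique-subs u) disjoint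
    where
    disjoint : ∀ {ys} → ¬ (ys ∈ map (x ∷_) (subs xs) × ys ∈ subs xs)
    disjoint (p , q) with ∈-map⁻ (x ∷_) p
    ... | zs , _ , refl = All.lookup x∉ (subs-⊆ q (here refl)) refl

  filterᵇ∈subs : ∀ (p : A → Bool) xs → filterᵇ p xs ∈ subs xs
  filterᵇ∈subs p [] = here refl
  filterᵇ∈subs p (x ∷ xs) with p x
  ... | true  = ∈-++⁺ˡ (∈-map⁺ (x ∷_) (filterᵇ∈subs p xs))
  ... | false = ∈-++⁺ʳ (map (x ∷_) (subs xs)) (filterᵇ∈subs p xs)

  -- Sublists inherit the order of the ambient list, so without duplicates only membership
  -- distinguishes them. This lets lists of chords stand for sets of chords.
  subs-extensional : ∀ {xs ys zs : List A} → Unique xs → ys ∈ subs xs → zs ∈ subs xs →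
    (∀ {x} → x ∈ ys → x ∈ zs) → (∀ {x} → x ∈ zs → x ∈ ys) → ys ≡ zs
  subs-extensional {[]} _ (here refl) (here refl) _ _ = refl
  subs-extensional {x ∷ xs} (x∉ ∷ u) p q f g
    with ∈-++⁻ (map (x ∷_) (subs xs)) p | ∈-++⁻ (map (x ∷_) (subs xs)) q
  ... | inj₂ p′ | inj₂ q′ = subs-extensional u p′ q′ f g
  ... | inj₁ p′ | inj₂ q′ with ∈-map⁻ (x ∷_) p′
  ... | _ , _ , refl = ⊥-elim (All.lookup x∉ (subs-⊆ q′ (f (here refl))) refl)
  subs-extensional {x ∷ xs} (x∉ ∷ u) p q f g | inj₂ p′ | inj₁ q′ with ∈-map⁻ (x ∷_) q′
  ... | _ , _ , refl = ⊥-elim (All.lookup x∉ (subs-⊆ p′ (g (here refl))) refl)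
  subs-extensional {x ∷ xs} (x∉ ∷ u) p q f g | inj₁ p′ | inj₁ q′ with ∈-map⁻ (x ∷_) p′ | ∈-map⁻ (x ∷_) q′
  ... | ys , ys∈ , refl | zs , zs∈ , refl =
    cong (x ∷_) (subs-extensional u ys∈ zs∈ (λ y∈ → tail (subs-⊆ ys∈ y∈) (f (there y∈)))
                                            (λ y∈ → tail (subs-⊆ zs∈ y∈) (g (there y∈))))
    where
    tail : ∀ {y ws} → y ∈ xs → y ∈ x ∷ ws → y ∈ ws
    tail y∈xs (here refl) = ⊥-elim (All.lookup x∉ y∈xs refl)
    tail _ (there y∈) = y∈

-- Reflection of the tests on vertices and segments

≡ᵇ⇒≡′ : ∀ {m n} → (m ≡ᵇ n) ≡ true → m ≡ n
≡ᵇ⇒≡′ {m} {n} p = ≡ᵇ⇒≡ m n (≡⇒T p)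

≡⇒≡ᵇ′ : ∀ {m n} → m ≡ n → (m ≡ᵇ n) ≡ true
≡⇒≡ᵇ′ {m} {n} p = T⇒≡ (≡⇒≡ᵇ m n p)

eqSeg⇒≡ : ∀ {p q} → T (eqSeg p q) → p ≡ q
eqSeg⇒≡ {a , b} {c , d} t with Equivalence.to T-∧ t
... | u , v = cong₂ _,_ (≡ᵇ⇒≡ a c u) (≡ᵇ⇒≡ b d v)

eqSeg-refl : ∀ p → T (eqSeg p p)
eqSeg-refl (a , b) = Equivalence.from T-∧ (≡⇒≡ᵇ a a refl , ≡⇒≡ᵇ b b refl)

elemSeg⇒∈ : ∀ {p D} → elemSeg p D ≡ true → p ∈ D
elemSeg⇒∈ {p} {D} e = Any.map eqSeg⇒≡ (any⁻ (eqSeg p) D (≡⇒T e))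

∈⇒elemSeg : ∀ {p D} → p ∈ D → elemSeg p D ≡ true
∈⇒elemSeg {p} p∈ = T⇒≡ (any⁺ (eqSeg p) (Any.map (λ { refl → eqSeg-refl p }) p∈))

elemℕ⇒∈ : ∀ {n S} → elemℕ n S ≡ true → n ∈ S
elemℕ⇒∈ {n} {S} e = Any.map (≡ᵇ⇒≡ n _) (any⁻ (n ≡ᵇ_) S (≡⇒T e))

∈⇒elemℕ : ∀ {n S} → n ∈ S → elemℕ n S ≡ true
∈⇒elemℕ {n} n∈ = T⇒≡ (any⁺ (n ≡ᵇ_) (Any.map (≡⇒≡ᵇ n _) n∈))

-- Increasing lists

Sorted : List ℕ → Set
Sorted = AllPairs _<_

module _ {A : Set} where

  pairs⁻ : ∀ {xs : List A} {i j} → (i , j) ∈ pairs xs → i ∈ xs × j ∈ xs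
  pairs⁻ {x ∷ xs} p∈ with ∈-++⁻ (map (x ,_) xs) p∈
  ... | inj₂ q = let i∈ , j∈ = pairs⁻ q in there i∈ , there j∈
  ... | inj₁ q with ∈-map⁻ (x ,_) q
  ... | _ , j∈ , refl = here refl , there j∈

  pairs⁺ : ∀ {xs : List A} {i j} → i ∈ xs → j ∈ xs → i ≡ j ⊎ ((i , j) ∈ pairs xs ⊎ (j , i) ∈ pairs xs)
  pairs⁺ (here refl) (here refl) = inj₁ refl
  pairs⁺ (here refl) (there j∈) = inj₂ (inj₁ (∈-++⁺ˡ (∈-map⁺ _ j∈)))
  pairs⁺ (there i∈) (here refl) = inj₂ (inj₂ (∈-++⁺ˡ (∈-map⁺ _ i∈)))
  pairs⁺ {x ∷ xs} (there i∈) (there j∈) with pairs⁺ i∈ j∈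
  ... | inj₁ e = inj₁ e
  ... | inj₂ (inj₁ q) = inj₂ (inj₁ (∈-++⁺ʳ (map (x ,_) xs) q))
  ... | inj₂ (inj₂ q) = inj₂ (inj₂ (∈-++⁺ʳ (map (x ,_) xs) q))

pairs-< : ∀ {S i j} → Sorted S → (i , j) ∈ pairs S → i < j
pairs-< {x ∷ S} (x< ∷ so) p∈ with ∈-++⁻ (map (x ,_) S) p∈
... | inj₂ q = pairs-< so q
... | inj₁ q with ∈-map⁻ (x ,_) q
... | _ , j∈ , refl = All.lookup x< j∈

∈-pairs : ∀ {S i j} → Sorted S → i ∈ S → j ∈ S → i < j → (i , j) ∈ pairs S
∈-pairs so i∈ j∈ i<j with pairs⁺ i∈ j∈
... | inj₁ refl = ⊥-elim (<-irrefl refl i<j)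
... | inj₂ (inj₁ p) = p
... | inj₂ (inj₂ p) = ⊥-elim (<-asym i<j (pairs-< so p))

∈-tail : ∀ {A : Set} {x y : A} {xs} → y ≢ x → y ∈ x ∷ xs → y ∈ xs
∈-tail y≢x (here e) = ⊥-elim (y≢x e)
∈-tail _ (there y∈) = y∈

[]∈subs : ∀ {A : Set} (xs : List A) → [] ∈ subs xs
[]∈subs [] = here refl
[]∈subs (x ∷ xs) = ∈-++⁺ʳ (map (x ∷_) (subs xs)) ([]∈subs xs)

subs-sorted : ∀ {xs S} → Sorted xs → S ∈ subs xs → Sorted S
subs-sorted {[]} _ (here refl) = []
subs-sorted {x ∷ xs} (x< ∷ so) S∈ with ∈-++⁻ (map (x ∷_) (subs xs)) S∈
... | inj₂ q = subs-sorted so q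
... | inj₁ q with ∈-map⁻ (x ∷_) q
... | T , T∈ , refl = All.tabulate (λ y∈ → All.lookup x< (subs-⊆ T∈ y∈)) ∷ subs-sorted so T∈

sorted∈subs : ∀ {xs S} → Sorted xs → Sorted S → (∀ {x} → x ∈ S → x ∈ xs) → S ∈ subs xs
sorted∈subs {xs} {[]} _ _ _ = []∈subs xs
sorted∈subs {[]} {y ∷ S} _ _ f with f (here refl)
... | ()
sorted∈subs {x ∷ xs} {y ∷ S} (x< ∷ so) (y< ∷ so′) f with f (here refl)
... | here refl = ∈-++⁺ˡ (∈-map⁺ (x ∷_) (sorted∈subs so so′
      (λ z∈ → ∈-tail (λ { refl → <-irrefl refl (All.lookup y< z∈) }) (f (there z∈)))))
... | there y∈ = ∈-++⁺ʳ (map (x ∷_) (subs xs)) (sorted∈subs so (y< ∷ so′) above)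
  where
  above : ∀ {z} → z ∈ y ∷ S → z ∈ xs
  above (here refl) = y∈
  above (there z∈) = ∈-tail (λ { refl → <-asym (All.lookup y< z∈) (All.lookup x< y∈) }) (f (there z∈))

sorted-upTo : ∀ n → Sorted (upTo n)
sorted-upTo n = AllPairs.applyUpTo⁺₁ id n (λ i<j _ → i<j)

-- `final` and `steps` are accessible copies of the private `lastOr` and `consec`, with the first
-- vertex of the path as a separate argument.
final : ℕ → List ℕ → ℕ
final a [] = a
final a (x ∷ xs) = final x xs

steps : ℕ → List ℕ → List Seg
steps a [] = []
steps a (x ∷ xs) = (a , x) ∷ steps x xs

-- The underscores stand for private functions of Defs, found by unification.
mutual
  consec≡steps : ∀ x xs → _ ≡ steps x xs
  lastOr≡final : ∀ x xs → _ ≡ final x xs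

  cycPairs≡ : ∀ x xs → cycPairs (x ∷ xs) ≡ steps x xs ++ [ (x , final x xs) ]
  cycPairs≡ x xs = cong₂ (λ u v → u ++ [ (x , v) ]) (consec≡steps x xs) (lastOr≡final x xs)

  consec≡steps x [] = refl
  consec≡steps x (y ∷ ys) = cong ((x , y) ∷_) (consec≡steps y ys)

  lastOr≡final x [] = refl
  lastOr≡final x (y ∷ ys) = lastOr≡final y ys

cycPairs⁻ : ∀ {a xs p} → p ∈ cycPairs (a ∷ xs) → p ∈ steps a xs ⊎ p ≡ (a , final a xs)
cycPairs⁻ {a} {xs} p∈ rewrite cycPairs≡ a xs with ∈-++⁻ (steps a xs) p∈
... | inj₁ q = inj₁ q
... | inj₂ (here e) = inj₂ e

steps⇒cycPairs : ∀ {a xs p} → p ∈ steps a xs → p ∈ cycPairs (a ∷ xs)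
steps⇒cycPairs {a} {xs} p∈ rewrite cycPairs≡ a xs = ∈-++⁺ˡ p∈

roof∈cycPairs : ∀ a xs → (a , final a xs) ∈ cycPairs (a ∷ xs)
roof∈cycPairs a xs rewrite cycPairs≡ a xs = ∈-++⁺ʳ (steps a xs) (here refl)

final∈ : ∀ a xs → final a xs ∈ a ∷ xs
final∈ a [] = here refl
final∈ a (x ∷ xs) = there (final∈ x xs)

head-min : ∀ {a xs x} → Sorted (a ∷ xs) → x ∈ a ∷ xs → a ≤ x
head-min _ (here refl) = ≤-refl
head-min (a< ∷ _) (there x∈) = <⇒≤ (All.lookup a< x∈)

final-max : ∀ {a xs x} → Sorted (a ∷ xs) → x ∈ a ∷ xs → x ≤ final a xs
final-max {xs = []} _ (here refl) = ≤-refl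
final-max {xs = y ∷ xs} ((a<y ∷ _) ∷ so) (here refl) = ≤-trans (<⇒≤ a<y) (final-max so (here refl))
final-max {xs = y ∷ xs} (_ ∷ so) (there x∈) = final-max so x∈

steps-∈ : ∀ {a xs i j} → (i , j) ∈ steps a xs → i ∈ a ∷ xs × j ∈ xs
steps-∈ {xs = x ∷ xs} (here refl) = here refl , here refl
steps-∈ {xs = x ∷ xs} (there p) = let i∈ , j∈ = steps-∈ p in there i∈ , there j∈

steps-< : ∀ {a xs i j} → Sorted (a ∷ xs) → (i , j) ∈ steps a xs → i < j
steps-< {xs = x ∷ xs} ((a<x ∷ _) ∷ _) (here refl) = a<x
steps-< {xs = x ∷ xs} (_ ∷ so) (there p) = steps-< so p

-- Discrete intermediate value property: a path from below `x` to above it lands on `x` or jumps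
-- over it in one step. That step is what an edge ending at `x` would cross.
straddle : ∀ {a xs x} → a ≤ x → x ≤ final a xs →
  x ∈ a ∷ xs ⊎ ∃[ u ] ∃[ v ] (u , v) ∈ steps a xs × u < x × x < v
straddle {xs = []} a≤x x≤a = inj₁ (here (≤-antisym x≤a a≤x))
straddle {a} {y ∷ xs} {x} a≤x x≤ with <-cmp x y
... | tri> _ _ y<x = Sum.map there (λ (u , v , p , q) → u , v , there p , q) (straddle (<⇒≤ y<x) x≤)
... | tri≈ _ refl _ = inj₁ (there (here refl))
... | tri< x<y _ _ with m≤n⇒m<n∨m≡n a≤x
... | inj₁ a<x = inj₂ (a , y , here refl , a<x , x<y)
... | inj₂ refl = inj₁ (here refl)

-- Faces of an edge predicate

_∋_ : (Seg → Bool) → Seg → Set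
E ∋ p = E p ≡ true

bool-ext : ∀ {a b} → (a ≡ true → b ≡ true) → (b ≡ true → a ≡ true) → a ≡ b
bool-ext {false} {false} f g = refl
bool-ext {true} {b} f g = sym (f refl)
bool-ext {false} {true} f g = g refl

-- This is `isFace` with the edge test abstracted, so that `faces (suc N) D` is definitionally
-- `facesOf (isEdge (suc N) D) N` and the same notion applies to predicates without the roof.
isFaceOf : (Seg → Bool) → List ℕ → Bool
isFaceOf E S = (2 <ᵇ length S) ∧ all (λ p → (E p ∧ elemSeg p (cycPairs S)) ∨ (not (E p) ∧ not (elemSeg p (cycPairs S)))) (pairs S)

facesOf : (Seg → Bool) → ℕ → List (List ℕ)
facesOf E N = filterᵇ (isFaceOf E) (subs (upTo (suc N)))

record Face (E : Seg → Bool) (S : List ℕ) : Set where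
  constructor face
  field
    sorted : Sorted S
    long   : 3 ≤ length S
    chordless : ∀ {i j} → i ∈ S → j ∈ S → i < j → E ∋ (i , j) → (i , j) ∈ cycPairs S
    cyclic    : ∀ {i j} → i ∈ S → j ∈ S → i < j → (i , j) ∈ cycPairs S → E ∋ (i , j)

agree⁺ : ∀ {a b} → a ≡ b → T ((a ∧ b) ∨ (not a ∧ not b))
agree⁺ {false} refl = _
agree⁺ {true} refl = _

agree⁻ : ∀ {a b} → T ((a ∧ b) ∨ (not a ∧ not b)) → a ≡ b
agree⁻ {false} {false} _ = refl
agree⁻ {true} {true} _ = refl

facesOf⁻ : ∀ {E N S} → S ∈ facesOf E N → Face E S × (∀ {x} → x ∈ S → x ≤ N)
facesOf⁻ {E} {N} {S} S∈ with ∈-filterᵇ⁻ (isFaceOf E) S∈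
... | S∈subs , isF with Equivalence.to T-∧ (≡⇒T isF)
... | lng , al = face so (<ᵇ⇒< 2 (length S) lng)
    (λ i∈ j∈ i<j e → elemSeg⇒∈ (trans (sym (ag i∈ j∈ i<j)) e))
    (λ i∈ j∈ i<j p∈ → trans (ag i∈ j∈ i<j) (∈⇒elemSeg p∈))
  , (λ x∈ → s≤s⁻¹ (∈-upTo⁻ (subs-⊆ S∈subs x∈)))
  where
  so = subs-sorted (sorted-upTo (suc N)) S∈subs
  ag : ∀ {i j} → i ∈ S → j ∈ S → i < j → E (i , j) ≡ elemSeg (i , j) (cycPairs S)
  ag i∈ j∈ i<j = agree⁻ (All.lookup (all⁺ _ (pairs S) al) (∈-pairs so i∈ j∈ i<j))

facesOf⁺ : ∀ {E N S} → Face E S → (∀ {x} → x ∈ S → x ≤ N) → S ∈ facesOf E N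
facesOf⁺ {E} {N} {S} (face so lng ch cy) bd = ∈-filterᵇ⁺ (isFaceOf E)
  (sorted∈subs (sorted-upTo (suc N)) so (λ x∈ → ∈-upTo⁺ (s≤s (bd x∈))))
  (T⇒≡ (Equivalence.from T-∧ (<⇒<ᵇ lng , all⁻ _ (All.tabulate ag))))
  where
  ag : ∀ {p} → p ∈ pairs S → _
  ag p∈ = let i∈ , j∈ = pairs⁻ p∈ ; i<j = pairs-< so p∈ in
    agree⁺ (bool-ext (λ e → ∈⇒elemSeg (ch i∈ j∈ i<j e)) (λ e → cy i∈ j∈ i<j (elemSeg⇒∈ e)))

unique-facesOf : ∀ E N → Unique (facesOf E N)
unique-facesOf E N = unique-filterᵇ (isFaceOf E) (unique-subs (Unique.upTo⁺ (suc N)))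

face-cong : ∀ {E E′ S} → (∀ {i j} → i ∈ S → j ∈ S → i < j → E (i , j) ≡ E′ (i , j)) → Face E S → Face E′ S
face-cong eq (face so lng ch cy) = face so lng
  (λ i∈ j∈ i<j e → ch i∈ j∈ i<j (trans (eq i∈ j∈ i<j) e))
  (λ i∈ j∈ i<j p∈ → trans (sym (eq i∈ j∈ i<j)) (cy i∈ j∈ i<j p∈))

head<final : ∀ {a xs} → Sorted (a ∷ xs) → 2 ≤ length (a ∷ xs) → a < final a xs
head<final {xs = []} _ (s≤s ())
head<final {xs = x ∷ xs} ((a<x ∷ _) ∷ so) _ = <-≤-trans a<x (final-max so (here refl))

-- The pair closing the cycle joins the extreme vertices. This locates faces: none can reach across
-- a vertex over which no edge passes, and none can contain both `0` and `N` when the roof is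
-- absent.
face-roof : ∀ {E a xs} → Face E (a ∷ xs) → E ∋ (a , final a xs)
face-roof {a = a} {xs} (face so lng ch cy) =
  cy (here refl) (final∈ a xs) (head<final so (<⇒≤ lng)) (roof∈cycPairs a xs)

-- Other pairs are ignored: no face, path or crossing on `0, …, N` inspects them, so translated and
-- glued predicates may take any value there.
Agree : ℕ → (Seg → Bool) → (Seg → Bool) → Set
Agree N E E′ = ∀ {i j} → i < j → j ≤ N → E (i , j) ≡ E′ (i , j)

agree-sym : ∀ {N E E′} → Agree N E E′ → Agree N E′ E
agree-sym ag i<j j≤N = sym (ag i<j j≤N)

Sides : ℕ → (Seg → Bool) → Set
Sides N E = ∀ {i} → i < N → E ∋ (i , suc i)

NonCrossing : ℕ → (Seg → Bool) → Set
NonCrossing N E = ∀ {a b c d} → a < c → c < b → b < d → d ≤ N → E ∋ (a , b) → ¬ E ∋ (c , d)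

nonCrossing-cong : ∀ {N E E′} → Agree N E E′ → NonCrossing N E → NonCrossing N E′
nonCrossing-cong ag nc a<c c<b b<d d≤N p q =
  nc a<c c<b b<d d≤N (trans (ag (<-trans a<c c<b) (≤-trans (<⇒≤ b<d) d≤N)) p)
                     (trans (ag (<-trans c<b b<d) d≤N) q)

facesOf-cong : ∀ {N E E′} → Agree N E E′ → facesOf E N ≡ facesOf E′ N
facesOf-cong {N} {E} {E′} ag = filterᵇ-cong (subs (upTo (suc N))) λ S∈ → bool-ext (go ag S∈) (go (agree-sym ag) S∈)
  where
  filterᵇ-cong : ∀ {A : Set} {p q : A → Bool} xs → (∀ {x} → x ∈ xs → p x ≡ q x) → filterᵇ p xs ≡ filterᵇ q xs
  filterᵇ-cong [] _ = refl
  filterᵇ-cong {p = p} {q} (x ∷ xs) eq with p x | q x | eq (here refl)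
  ... | true  | .true  | refl = cong (x ∷_) (filterᵇ-cong xs (eq ∘ there))
  ... | false | .false | refl = filterᵇ-cong xs (eq ∘ there)
  go : ∀ {E E′ S} → Agree N E E′ → S ∈ subs (upTo (suc N)) → isFaceOf E S ≡ true → isFaceOf E′ S ≡ true
  go {E} {E′} ag S∈ isF with facesOf⁻ {E} {N} (∈-filterᵇ⁺ (isFaceOf E) S∈ isF)
  ... | f , bd = proj₂ (∈-filterᵇ⁻ (isFaceOf E′) {xs = subs (upTo (suc N))} (facesOf⁺ {E′} {N} (face-cong (λ _ j∈ i<j → ag i<j (bd j∈)) f) bd))

-- Outer paths

-- Outer E N a xs: the path a ∷ xs from a to N takes the longest available edge at each vertex.
data Outer (E : Seg → Bool) (N : ℕ) : ℕ → List ℕ → Set where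
  done : Outer E N N []
  step : ∀ {a s xs} → a < s → s ≤ N → E ∋ (a , s) → (∀ {j} → s < j → j ≤ N → ¬ E ∋ (a , j)) →
         Outer E N s xs → Outer E N a (s ∷ xs)

outer-cong : ∀ {E E′ N a xs} → Agree N E E′ → Outer E N a xs → Outer E′ N a xs
outer-cong ag done = done
outer-cong ag (step a<s s≤N e mx o) = step a<s s≤N (trans (sym (ag a<s s≤N)) e)
  (λ s<j j≤N e′ → mx s<j j≤N (trans (ag (<-trans a<s s<j) j≤N) e′)) (outer-cong ag o)

outer-sorted : ∀ {E N a xs} → Outer E N a xs → Sorted (a ∷ xs)
outer-sorted done = [] ∷ []
outer-sorted (step a<s _ _ _ o) with outer-sorted o
... | s< ∷ so = (a<s ∷ All.map (<-trans a<s) s<) ∷ s< ∷ so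

outer-final : ∀ {E N a xs} → Outer E N a xs → final a xs ≡ N
outer-final done = refl
outer-final (step _ _ _ _ o) = outer-final o

outer-functional : ∀ {E N a xs ys} → Outer E N a xs → Outer E N a ys → xs ≡ ys
outer-functional done done = refl
outer-functional done (step a<s s≤N _ _ _) = ⊥-elim (<⇒≱ a<s s≤N)
outer-functional (step a<s s≤N _ _ _) done = ⊥-elim (<⇒≱ a<s s≤N)
outer-functional (step {s = s} a<s s≤N e mx o) (step {s = s′} a<s′ s′≤N e′ mx′ o′) with <-cmp s s′
... | tri< s<s′ _ _ = ⊥-elim (mx s<s′ s′≤N e′)
... | tri> _ _ s′<s = ⊥-elim (mx′ s′<s s≤N e)
... | tri≈ _ refl _ = cong (s ∷_) (outer-functional o o′)

largest : ∀ (E : Seg → Bool) a N →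
  (∃[ s ] a < s × s ≤ N × E ∋ (a , s) × (∀ {j} → s < j → j ≤ N → ¬ E ∋ (a , j)))
  ⊎ (∀ {j} → a < j → j ≤ N → ¬ E ∋ (a , j))
largest E a zero = inj₂ (λ { a<j z≤n e → n≮0 a<j })
largest E a (suc N) with a <? suc N | E (a , suc N) in eq
... | no a≮ | _ = inj₂ (λ a<j j≤N _ → a≮ (<-≤-trans a<j j≤N))
... | yes a<N | true = inj₁ (suc N , a<N , ≤-refl , eq , λ s<j j≤N _ → <⇒≱ s<j j≤N)
... | yes a<N | false = Sum.map
  (λ (s , a<s , s≤N , e , mx) → s , a<s , m≤n⇒m≤1+n s≤N , e , λ s<j → extend (mx s<j))
  (λ none a<j → extend (none a<j))
  (largest E a N)
  where
  extend : ∀ {j} → (j ≤ N → ¬ E ∋ (a , j)) → j ≤ suc N → ¬ E ∋ (a , j)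
  extend f j≤ e with m≤n⇒m<n∨m≡n j≤
  ... | inj₁ j<sN = f (s≤s⁻¹ j<sN) e
  ... | inj₂ refl = not-¬ eq e

-- The side at each vertex before `N` guarantees a candidate for the next step; the fuel bounds the
-- remaining distance.
outer-exists : ∀ {E N} → Sides N E → ∀ {a} → a ≤ N → ∃[ xs ] Outer E N a xs
outer-exists {E} {N} sides {a} a≤N = go (N ∸ a) a≤N ≤-refl
  where
  go : ∀ fuel {a} → a ≤ N → N ∸ a ≤ fuel → ∃[ xs ] Outer E N a xs
  go fuel {a} a≤N fits with m≤n⇒m<n∨m≡n a≤N
  ... | inj₂ refl = [] , done
  go zero a≤N fits | inj₁ a<N = ⊥-elim (<⇒≱ a<N (m∸n≡0⇒m≤n (n≤0⇒n≡0 fits)))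
  go (suc fuel) {a} a≤N fits | inj₁ a<N with largest E a N
  ... | inj₂ none = ⊥-elim (none ≤-refl a<N (sides a<N))
  ... | inj₁ (s , a<s , s≤N , e , mx) with go fuel s≤N (s≤s⁻¹ (≤-trans (∸-monoʳ-< a<s s≤N) fits))
  ... | xs , o = s ∷ xs , step a<s s≤N e mx o

-- The path is an induced subgraph. A face through `0` and `N` is such a path closed by the roof, so
-- this notion links `Face` with `Outer`.
Induced : (Seg → Bool) → ℕ → List ℕ → Set
Induced E a xs = ∀ {i j} → i ∈ a ∷ xs → j ∈ a ∷ xs → i < j → (E ∋ (i , j) → (i , j) ∈ steps a xs) × ((i , j) ∈ steps a xs → E ∋ (i , j))

-- A chord from the first vertex would reach beyond its successor, against the maximality of that
-- step; all other pairs belong to the rest of the path.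
outer⇒induced : ∀ {E N a xs} → Outer E N a xs → Induced E a xs
outer⇒induced done (here refl) (here refl) i<j = ⊥-elim (<-irrefl refl i<j)
outer⇒induced (step a<s _ e mx o) (here refl) (here refl) i<j = ⊥-elim (<-irrefl refl i<j)
outer⇒induced (step a<s _ e mx o) (here refl) (there (here refl)) _ = (λ _ → here refl) , λ _ → e
outer⇒induced (step {a} {s} {xs} a<s _ e mx o) (here refl) (there (there {xs = .xs} j∈)) _ =
  (λ e′ → ⊥-elim (mx (All.lookup s< j∈) j≤N e′)) , λ p∈ → ⊥-elim (not-step p∈)
  where
  so = outer-sorted o
  s< = AllPairs.head so
  j≤N = subst (_ ≤_) (outer-final o) (final-max so (there j∈))
  not-step : ¬ (a , _) ∈ (a , s) ∷ steps s xs
  not-step (here refl) = <-irrefl refl (All.lookup s< j∈)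
  not-step (there p∈) = <⇒≱ a<s (head-min so (proj₁ (steps-∈ p∈)))
outer⇒induced (step {a} {s} {xs} a<s _ e mx o) (there i∈) (here refl) i<j =
  ⊥-elim (<⇒≱ (<-trans i<j a<s) (head-min (outer-sorted o) i∈))
outer⇒induced (step {a} {s} {xs} a<s _ e mx o) (there i∈) (there j∈) i<j with outer⇒induced o i∈ j∈ i<j
... | f , g = (there ∘ f) , λ { (here refl) → ⊥-elim (<⇒≱ a<s (head-min (outer-sorted o) i∈)) ; (there p∈) → g p∈ }

-- An edge leaving a beyond its successor s would be a chord of the path, or cross one of its steps.
induced⇒outer : ∀ {E N a xs} → NonCrossing N E → Sorted (a ∷ xs) → final a xs ≡ N → Induced E a xs → Outer E N a xs
induced⇒outer {xs = []} nc so refl ind = done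
induced⇒outer {E} {N} {a} {s ∷ xs} nc so@((a<s ∷ _) ∷ so′) refl ind =
  step a<s (final-max so′ (here refl)) (proj₂ (ind (here refl) (there (here refl)) a<s) (here refl))
    maximal (induced⇒outer nc so′ refl ind′)
  where
  ind′ : Induced E s xs
  ind′ i∈ j∈ i<j with ind (there i∈) (there j∈) i<j
  ... | f , g = (λ e → ∈-tail (λ { refl → <⇒≱ a<s (head-min so′ i∈) }) (f e)) , g ∘ there
  maximal : ∀ {j} → s < j → j ≤ N → ¬ E ∋ (a , j)
  maximal {j} s<j j≤N e with straddle {s} {xs} (<⇒≤ s<j) j≤N
  ... | inj₁ j∈ with proj₁ (ind (here refl) (there j∈) (<-trans a<s s<j)) e
  ... | here refl = <-irrefl refl s<j
  ... | there p∈ = <⇒≱ a<s (head-min so′ (proj₁ (steps-∈ p∈)))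
  maximal {j} s<j j≤N e | inj₂ (u , v , uv∈ , u<j , j<v) with steps-∈ uv∈
  ... | u∈ , v∈ = nc (<-≤-trans a<s (head-min so′ u∈)) u<j j<v (final-max so′ (there v∈)) e
                     (proj₂ (ind′ u∈ (there v∈) (<-trans u<j j<v)) uv∈)

-- Translation of vertices

shift : ℕ → Seg → Seg
shift s (i , j) = s + i , s + j

final-map : ∀ s a xs → final (s + a) (map (s +_) xs) ≡ s + final a xs
final-map s a [] = refl
final-map s a (x ∷ xs) = final-map s x xs

steps-map : ∀ s a xs → steps (s + a) (map (s +_) xs) ≡ map (shift s) (steps a xs)
steps-map s a [] = refl
steps-map s a (x ∷ xs) = cong (_ ∷_) (steps-map s x xs)

cycPairs-map : ∀ s S → cycPairs (map (s +_) S) ≡ map (shift s) (cycPairs S)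
cycPairs-map s [] = refl
cycPairs-map s (a ∷ xs) rewrite cycPairs≡ (s + a) (map (s +_) xs) | cycPairs≡ a xs
  | map-++ (shift s) (steps a xs) [ (a , final a xs) ] | steps-map s a xs | final-map s a xs = refl

shift-injective : ∀ s {p q} → shift s p ≡ shift s q → p ≡ q
shift-injective s eq = cong₂ _,_ (+-cancelˡ-≡ s _ _ (cong proj₁ eq)) (+-cancelˡ-≡ s _ _ (cong proj₂ eq))

∈-cycPairs-map⁺ : ∀ s S {p} → p ∈ cycPairs S → shift s p ∈ cycPairs (map (s +_) S)
∈-cycPairs-map⁺ s S p∈ = subst (_ ∈_) (sym (cycPairs-map s S)) (∈-map⁺ (shift s) p∈)

∈-cycPairs-map⁻ : ∀ s S {p} → shift s p ∈ cycPairs (map (s +_) S) → p ∈ cycPairs S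
∈-cycPairs-map⁻ s S p∈ with ∈-map⁻ (shift s) (subst (_ ∈_) (cycPairs-map s S) p∈)
... | q , q∈ , eq = subst (_∈ cycPairs S) (sym (shift-injective s eq)) q∈

face-shift⁻ : ∀ {E} s {S} → Face E (map (s +_) S) → Face (E ∘ shift s) S
face-shift⁻ s {S} (face so lng ch cy) = face
  (AllPairs.map (+-cancelˡ-< s _ _) (AllPairs.map⁻ so))
  (subst (3 ≤_) (length-map (s +_) S) lng)
  (λ i∈ j∈ i<j e → ∈-cycPairs-map⁻ s S (ch (∈-map⁺ _ i∈) (∈-map⁺ _ j∈) (+-monoʳ-< s i<j) e))
  (λ i∈ j∈ i<j p∈ → cy (∈-map⁺ _ i∈) (∈-map⁺ _ j∈) (+-monoʳ-< s i<j) (∈-cycPairs-map⁺ s S p∈))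

face-shift⁺ : ∀ {E} s {S} → Face (E ∘ shift s) S → Face E (map (s +_) S)
face-shift⁺ {E} s {S} (face so lng ch cy) = face
  (AllPairs.map⁺ (AllPairs.map (+-monoʳ-< s) so))
  (subst (3 ≤_) (sym (length-map (s +_) S)) lng) chordless cyclic
  where
  chordless : ∀ {i j} → i ∈ map (s +_) S → j ∈ map (s +_) S → i < j → E ∋ (i , j) → (i , j) ∈ cycPairs (map (s +_) S)
  chordless i∈ j∈ i<j e with ∈-map⁻ (s +_) i∈ | ∈-map⁻ (s +_) j∈
  ... | _ , i∈′ , refl | _ , j∈′ , refl = ∈-cycPairs-map⁺ s S (ch i∈′ j∈′ (+-cancelˡ-< s _ _ i<j) e)
  cyclic : ∀ {i j} → i ∈ map (s +_) S → j ∈ map (s +_) S → i < j → (i , j) ∈ cycPairs (map (s +_) S) → E ∋ (i , j)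
  cyclic i∈ j∈ i<j p∈ with ∈-map⁻ (s +_) i∈ | ∈-map⁻ (s +_) j∈
  ... | _ , i∈′ , refl | _ , j∈′ , refl = cy i∈′ j∈′ (+-cancelˡ-< s _ _ i<j) (∈-cycPairs-map⁻ s S p∈)

unshift : ∀ s S → (∀ {x} → x ∈ S → s ≤ x) → ∃[ S′ ] S ≡ map (s +_) S′
unshift s [] _ = [] , refl
unshift s (x ∷ S) bd with unshift s S (bd ∘ there)
... | S′ , refl = (x ∸ s) ∷ S′ , cong (_∷ map (s +_) S′) (sym (m+[n∸m]≡n (bd (here refl))))

outer-shift⁺ : ∀ {E} s {n a xs} → Outer (E ∘ shift s) n a xs → Outer E (s + n) (s + a) (map (s +_) xs)
outer-shift⁺ s done = done
outer-shift⁺ {E} s {n} {a} (step {s = t} a<t t≤n e mx o) = step (+-monoʳ-< s a<t) (+-monoʳ-≤ s t≤n) e mx′ (outer-shift⁺ s o)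
  where
  mx′ : ∀ {j} → s + t < j → j ≤ s + n → ¬ E ∋ (s + a , j)
  mx′ {j} t<j j≤n e′ with m≤n⇒∃[o]m+o≡n (≤-trans (m≤m+n s t) (<⇒≤ t<j))
  ... | k , refl = mx (+-cancelˡ-< s _ _ t<j) (+-cancelˡ-≤ s _ _ j≤n) e′

-- The start is a variable `b` with an equation, since matching `done` directly would require
-- unifying `s + n` with `s + a`.
outer-shift⁻ : ∀ {E} s {n a b xs} → Outer E (s + n) b xs → b ≡ s + a →
  ∃[ ys ] xs ≡ map (s +_) ys × Outer (E ∘ shift s) n a ys
outer-shift⁻ s {n} {a} done eq with +-cancelˡ-≡ s n a eq
... | refl = [] , refl , done
outer-shift⁻ s {n} {a} (step {s = t} a<t t≤n e mx o) refl with m≤n⇒∃[o]m+o≡n (≤-trans (m≤m+n s a) (<⇒≤ a<t))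
... | k , refl with outer-shift⁻ s o refl
... | ys , refl , o′ = k ∷ ys , refl , step (+-cancelˡ-< s _ _ a<t) (+-cancelˡ-≤ s _ _ t≤n) e
  (λ k<j j≤n → mx (+-monoʳ-< s k<j) (+-monoʳ-≤ s j≤n)) o′

-- Cutting at a vertex that no edge passes over

record Split (E E₁ E₂ : Seg → Bool) (s n : ℕ) : Set where
  constructor split
  field
    left  : Agree s E E₁
    right : Agree n (E ∘ shift s) E₂
    gap   : ∀ {i j} → i < s → s < j → j ≤ s + n → ¬ E ∋ (i , j)

split-nonCrossing⁻ : ∀ {E E₁ E₂ s n} → Split E E₁ E₂ s n → NonCrossing (s + n) E → NonCrossing s E₁ × NonCrossing n E₂
split-nonCrossing⁻ {s = s} {n} (split left right gap) nc =
    nonCrossing-cong left (λ a<c c<b b<d d≤s → nc a<c c<b b<d (≤-trans d≤s (m≤m+n s n)))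
  , nonCrossing-cong right (λ a<c c<b b<d d≤n → nc (+-monoʳ-< s a<c) (+-monoʳ-< s c<b) (+-monoʳ-< s b<d) (+-monoʳ-≤ s d≤n))

-- Crossing chords overlap, so if neither passes over `s`, both lie on the same side of it.
split-nonCrossing⁺ : ∀ {E E₁ E₂ s n} → Split E E₁ E₂ s n → NonCrossing s E₁ → NonCrossing n E₂ → NonCrossing (s + n) E
split-nonCrossing⁺ {E} {s = s} {n} (split left right gap) nc₁ nc₂ {a} {b} {c} {d} a<c c<b b<d d≤N ab cd with d ≤? s
... | yes d≤s = nonCrossing-cong (agree-sym left) nc₁ a<c c<b b<d d≤s ab cd
... | no d≰s with c <? s
... | yes c<s = gap c<s (≰⇒> d≰s) d≤N cd
... | no c≮s with a <? s
... | yes a<s = gap a<s (≤-<-trans (≮⇒≥ c≮s) c<b) (≤-trans (<⇒≤ b<d) d≤N) ab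
... | no a≮s with m≤n⇒∃[o]m+o≡n (≮⇒≥ a≮s)
... | a′ , refl with m≤n⇒∃[o]m+o≡n (≤-trans (m≤m+n s a′) (<⇒≤ a<c))
... | c′ , refl with m≤n⇒∃[o]m+o≡n (≤-trans (m≤m+n s c′) (<⇒≤ c<b))
... | b′ , refl with m≤n⇒∃[o]m+o≡n (≤-trans (m≤m+n s b′) (<⇒≤ b<d))
... | d′ , refl = nonCrossing-cong (agree-sym right) nc₂ (+-cancelˡ-< s _ _ a<c) (+-cancelˡ-< s _ _ c<b)
                    (+-cancelˡ-< s _ _ b<d) (+-cancelˡ-≤ s _ _ d≤N) ab cd

-- The edge joining the extreme vertices of a face cannot pass over `s`, so every face lies on one
-- side. None is counted twice: the second vertex of a face on the right exceeds `s`.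
split-faces : ∀ {E E₁ E₂ s n} → Split E E₁ E₂ s n →
  facesOf E (s + n) ↭ facesOf E₁ s ++ map (map (s +_)) (facesOf E₂ n)
split-faces {E} {E₁} {E₂} {s} {n} (split left right gap) = sameElements⇒↭ (unique-facesOf E (s + n))
  (Unique.++⁺ (unique-facesOf E₁ s) (Unique.map⁺ (map-injective (+-cancelˡ-≡ s _ _)) (unique-facesOf E₂ n)) disjoint) to from
  where
  disjoint : ∀ {S} → ¬ (S ∈ facesOf E₁ s × S ∈ map (map (s +_)) (facesOf E₂ n))
  disjoint (p , q) with ∈-map⁻ (map (s +_)) q
  disjoint (p , q) | [] , S∈ , refl with facesOf⁻ {E₁} {s} p
  ... | face _ () _ _ , _
  disjoint (p , q) | _ ∷ [] , S∈ , refl with facesOf⁻ {E₁} {s} p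
  ... | face _ (s≤s ()) _ _ , _
  disjoint (p , q) | a ∷ b ∷ S , S∈ , refl with facesOf⁻ {E₁} {s} p
  ... | face ((a<b ∷ _) ∷ _) _ _ _ , bd = <⇒≱ (≤-<-trans (m≤m+n s a) a<b) (bd (there (here refl)))
  to : ∀ {S} → S ∈ facesOf E (s + n) → S ∈ facesOf E₁ s ++ map (map (s +_)) (facesOf E₂ n)
  to {S} S∈ with facesOf⁻ {E} {s + n} S∈
  to {[]} S∈ | face _ () _ _ , _
  to {a ∷ xs} S∈ | f , bd with final a xs ≤? s
  ... | yes ≤s = ∈-++⁺ˡ (facesOf⁺ (face-cong (λ _ j∈ i<j → left i<j (below-s j∈)) f) below-s)
    where
    below-s : ∀ {x} → x ∈ a ∷ xs → x ≤ s
    below-s x∈ = ≤-trans (final-max (Face.sorted f) x∈) ≤s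
  ... | no ≰s with a <? s
  ... | yes a<s = ⊥-elim (gap a<s (≰⇒> ≰s) (bd (final∈ a xs)) (face-roof f))
  ... | no a≮s with unshift s (a ∷ xs) (λ x∈ → ≤-trans (≮⇒≥ a≮s) (head-min (Face.sorted f) x∈))
  ... | S′ , eq = ∈-++⁺ʳ (facesOf E₁ s) (subst (_∈ map (map (s +_)) (facesOf E₂ n)) (sym eq)
                    (∈-map⁺ (map (s +_)) (facesOf⁺ (face-cong (λ _ j∈ i<j → right i<j (bd′ j∈))
                      (face-shift⁻ s (subst (Face E) eq f))) bd′)))
    where
    bd′ : ∀ {x} → x ∈ S′ → x ≤ n
    bd′ x∈ = +-cancelˡ-≤ s _ _ (bd (subst (_ ∈_) (sym eq) (∈-map⁺ (s +_) x∈)))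
  from : ∀ {S} → S ∈ facesOf E₁ s ++ map (map (s +_)) (facesOf E₂ n) → S ∈ facesOf E (s + n)
  from S∈ with ∈-++⁻ (facesOf E₁ s) S∈
  ... | inj₁ p = let f , bd = facesOf⁻ {E₁} {s} p in
    facesOf⁺ (face-cong (λ _ j∈ i<j → sym (left i<j (bd j∈))) f) (λ x∈ → ≤-trans (bd x∈) (m≤m+n s n))
  ... | inj₂ q with ∈-map⁻ (map (s +_)) q
  ... | S′ , S′∈ , refl with facesOf⁻ {E₂} {n} S′∈
  ... | f , bd = facesOf⁺ (face-shift⁺ {E} s (face-cong (λ _ j∈ i<j → sym (right i<j (bd j∈))) f)) bd′
    where
    bd′ : ∀ {x} → x ∈ map (s +_) S′ → x ≤ s + n
    bd′ x∈ with ∈-map⁻ (s +_) x∈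
    ... | _ , y∈ , refl = +-monoʳ-≤ s (bd y∈)

-- At the vertex `0`, the gap condition is the maximality of the first step `(0 , s)`.
outer-split⁺ : ∀ {E E₁ E₂ s n xs} → Split E E₁ E₂ s n → 0 < s → Outer E₁ s 0 [ s ] → Outer E₂ n 0 xs →
  Outer E (s + n) 0 (s ∷ map (s +_) xs)
outer-split⁺ {E} {s = s} {n} {xs} (split left right gap) 0<s (step _ _ e _ _) o =
  step 0<s (m≤m+n s n) (trans (left 0<s ≤-refl) e) (gap 0<s)
    (subst (λ a → Outer E (s + n) a (map (s +_) xs)) (+-identityʳ s) (outer-shift⁺ s (outer-cong (agree-sym right) o)))

-- The first step (0 , s) of the outer path is a maximal edge at 0, hence no edge passes over s.
outer-gap : ∀ {E N s xs} → NonCrossing N E → Outer E N 0 (s ∷ xs) → ∀ {i j} → i < s → s < j → j ≤ N → ¬ E ∋ (i , j)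
outer-gap nc (step _ _ e mx _) {zero} i<s s<j j≤N = mx s<j j≤N
outer-gap nc (step _ _ e mx _) {suc i} i<s s<j j≤N = nc z<s i<s s<j j≤N e

outer-split⁻ : ∀ {E E₁ E₂ s n xs} → Split E E₁ E₂ s n → Outer E (s + n) 0 (s ∷ xs) →
  Outer E₁ s 0 [ s ] × ∃[ ys ] xs ≡ map (s +_) ys × Outer E₂ n 0 ys
outer-split⁻ {s = s} (split left right gap) (step 0<s _ e mx o) with outer-shift⁻ s {a = 0} o (sym (+-identityʳ s))
... | ys , eq , o′ = step 0<s ≤-refl (trans (sym (left 0<s ≤-refl)) e) (λ s<j j≤s _ → <⇒≱ s<j j≤s) done
                   , ys , eq , outer-cong right o′

-- Removing the roof

record Roof (E E′ : Seg → Bool) (N : ℕ) : Set where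
  constructor roof
  field
    same    : ∀ {i j} → i < j → j ≤ N → (i , j) ≢ (0 , N) → E (i , j) ≡ E′ (i , j)
    present : E ∋ (0 , N)
    absent  : ¬ E′ ∋ (0 , N)

-- The roof joins the extreme vertices and so takes part in no crossing; on all other pairs the
-- predicates coincide.
roof-nonCrossing : ∀ {E E′ N} → Roof E E′ N → (NonCrossing N E → NonCrossing N E′) × (NonCrossing N E′ → NonCrossing N E)
roof-nonCrossing {N = N} (roof same _ _) =
    (λ nc a<c c<b b<d d≤N ab cd → nc a<c c<b b<d d≤N
      (trans (same (<-trans a<c c<b) (≤-trans (<⇒≤ b<d) d≤N) (left b<d d≤N)) ab)
      (trans (same (<-trans c<b b<d) d≤N (right a<c)) cd))
  , (λ nc a<c c<b b<d d≤N ab cd → nc a<c c<b b<d d≤N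
      (trans (sym (same (<-trans a<c c<b) (≤-trans (<⇒≤ b<d) d≤N) (left b<d d≤N))) ab)
      (trans (sym (same (<-trans c<b b<d) d≤N (right a<c))) cd))
  where
  left : ∀ {a b d} → b < d → d ≤ N → (a , b) ≢ (0 , N)
  left b<d d≤N refl = <⇒≱ b<d d≤N
  right : ∀ {a c d} → a < c → (c , d) ≢ (0 , N)
  right a<c refl = n≮0 a<c

roof∉steps : ∀ {a xs} → Sorted (a ∷ xs) → 2 ≤ length xs → (a , final a xs) ∉ steps a xs
roof∉steps {xs = x ∷ []} _ (s≤s ()) _
roof∉steps {xs = x ∷ y ∷ xs} (_ ∷ (x<y ∷ _) ∷ so) _ (here eq) =
  <⇒≱ x<y (≤-trans (final-max so (here refl)) (≤-reflexive (cong proj₂ eq)))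
roof∉steps {xs = x ∷ y ∷ xs} ((a<x ∷ _) ∷ so) _ (there p) = <⇒≱ a<x (head-min so (proj₁ (steps-∈ p)))

-- A one-step path from `0` to `N` would be the roof itself. The second step supplies the third
-- vertex of the central face.
outer-long : ∀ {E N xs} → Outer E N 0 xs → 0 < N → ¬ E ∋ (0 , N) → 2 ≤ length xs
outer-long done () _
outer-long (step _ _ e _ done) _ ¬e = ⊥-elim (¬e e)
outer-long (step _ _ _ _ (step _ _ _ _ _)) _ _ = s≤s (s≤s z≤n)

spanning : ∀ {N a xs} → Sorted (a ∷ xs) → (∀ {x} → x ∈ a ∷ xs → x ≤ N) → 0 ∈ a ∷ xs → N ∈ a ∷ xs → a ≡ 0 × final a xs ≡ N
spanning {a = a} {xs} so bd 0∈ N∈ = n≤0⇒n≡0 (head-min so 0∈) , ≤-antisym (bd (final∈ a xs)) (final-max so N∈)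

module _ {E E′ N} (rf : Roof E E′ N) (nc : NonCrossing N E′) (0<N : 0 < N) {xs} (o : Outer E′ N 0 xs) where
  open Roof rf

  -- The edges of `E′` among the vertices of the outer path are exactly its steps, and the roof adds
  -- the one missing side of the cycle.
  central∈ : 0 ∷ xs ∈ facesOf E N
  central∈ = facesOf⁺ (face so (s≤s (outer-long o 0<N absent)) chordless cyclic) bd
    where
    so = outer-sorted o
    bd : ∀ {x} → x ∈ 0 ∷ xs → x ≤ N
    bd x∈ = subst (_ ≤_) (outer-final o) (final-max so x∈)
    chordless : ∀ {i j} → i ∈ 0 ∷ xs → j ∈ 0 ∷ xs → i < j → E ∋ (i , j) → (i , j) ∈ cycPairs (0 ∷ xs)
    chordless {i} {j} i∈ j∈ i<j e with i ≟ 0 | j ≟ N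
    ... | yes refl | yes refl = subst (λ k → (0 , k) ∈ cycPairs (0 ∷ xs)) (outer-final o) (roof∈cycPairs 0 xs)
    ... | no i≢ | _ = steps⇒cycPairs (proj₁ (outer⇒induced o i∈ j∈ i<j) (trans (sym (same i<j (bd j∈) (i≢ ∘ cong proj₁))) e))
    ... | yes _ | no j≢ = steps⇒cycPairs (proj₁ (outer⇒induced o i∈ j∈ i<j) (trans (sym (same i<j (bd j∈) (j≢ ∘ cong proj₂))) e))
    cyclic : ∀ {i j} → i ∈ 0 ∷ xs → j ∈ 0 ∷ xs → i < j → (i , j) ∈ cycPairs (0 ∷ xs) → E ∋ (i , j)
    cyclic i∈ j∈ i<j p∈ with cycPairs⁻ p∈
    ... | inj₂ refl = subst (λ k → E ∋ (0 , k)) (sym (outer-final o)) present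
    ... | inj₁ q with proj₂ (outer⇒induced o i∈ j∈ i<j) q
    ... | e′ = trans (same i<j (bd j∈) (λ { refl → absent e′ })) e′

  -- Without the roof, such a face is an induced path from `0` to `N`, and by non-crossing an
  -- induced path is the outer path. So the central polygon has one vertex more than there are outer
  -- edges.
  central-unique : ∀ {S} → S ∈ facesOf E N → 0 ∈ S → N ∈ S → S ≡ 0 ∷ xs
  central-unique {S} S∈ 0∈ N∈ with facesOf⁻ {E} {N} S∈
  central-unique {a ∷ ys} S∈ 0∈ N∈ | face so lng ch cy , bd with spanning so bd 0∈ N∈
  ... | refl , fin = cong (0 ∷_) (outer-functional (induced⇒outer nc so fin ind) o)
    where
    ind : Induced E′ 0 ys
    ind i∈ j∈ i<j = fwd , bwd
      where
      fwd : E′ ∋ (_ , _) → (_ , _) ∈ steps 0 ys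
      fwd e′ with cycPairs⁻ (ch i∈ j∈ i<j (trans (same i<j (bd j∈) (λ { refl → absent e′ })) e′))
      ... | inj₁ q = q
      ... | inj₂ refl = ⊥-elim (absent (subst (λ k → E′ ∋ (0 , k)) fin e′))
      bwd : (_ , _) ∈ steps 0 ys → E′ ∋ (_ , _)
      -- A face has at least three vertices, so its path has at least two steps and the roof is none
      -- of them.
      bwd q = trans (sym (same i<j (bd j∈) (λ { refl → roof∉steps so (s≤s⁻¹ lng) (subst (λ k → (0 , k) ∈ steps 0 ys) (sym fin) q) })))
        (cy i∈ j∈ i<j (steps⇒cycPairs q))

  -- A face missing `0` or `N` never inspects the roof and is a face for both predicates. One
  -- containing both is central in `E`, and is impossible in `E′`, where its closing edge would be
  -- the absent roof.
  roof-faces : facesOf E N ↭ (0 ∷ xs) ∷ facesOf E′ N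
  roof-faces = sameElements⇒↭ (unique-facesOf E N)
    (All.tabulate (λ { S∈ refl → not-spanning S∈ (here refl) (subst (_∈ 0 ∷ xs) (outer-final o) (final∈ 0 xs)) }) ∷ unique-facesOf E′ N) to from
    where
    not-spanning : ∀ {S} → S ∈ facesOf E′ N → 0 ∈ S → ¬ N ∈ S
    not-spanning {S} S∈ 0∈ N∈ with facesOf⁻ {E′} {N} S∈
    not-spanning {a ∷ ys} S∈ 0∈ N∈ | f , bd with spanning (Face.sorted f) bd 0∈ N∈
    ... | refl , fin = absent (subst (λ k → E′ ∋ (0 , k)) fin (face-roof f))
    to : ∀ {S} → S ∈ facesOf E N → S ∈ (0 ∷ xs) ∷ facesOf E′ N
    to {S} S∈ with facesOf⁻ {E} {N} S∈
    to {[]} S∈ | face _ () _ _ , _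
    to {a ∷ ys} S∈ | f , bd with a ≟ 0 | final a ys ≟ N
    ... | yes refl | yes fin = here (central-unique S∈ (here refl) (subst (_∈ a ∷ ys) fin (final∈ a ys)))
    ... | no a≢ | _ = there (facesOf⁺ (face-cong (λ i∈ j∈ i<j → same i<j (bd j∈)
            (λ { refl → a≢ (n≤0⇒n≡0 (head-min (Face.sorted f) i∈)) })) f) bd)
    ... | yes _ | no fin≢ = there (facesOf⁺ (face-cong (λ i∈ j∈ i<j → same i<j (bd j∈)
            (λ { refl → fin≢ (≤-antisym (bd (final∈ a ys)) (final-max (Face.sorted f) j∈)) })) f) bd)
    from : ∀ {S} → S ∈ (0 ∷ xs) ∷ facesOf E′ N → S ∈ facesOf E N
    from (here refl) = central∈
    from (there S∈) with facesOf⁻ {E′} {N} S∈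
    ... | f , bd = facesOf⁺ (face-cong (λ i∈ j∈ i<j → sym (same i<j (bd j∈) (λ { refl → not-spanning S∈ i∈ j∈ }))) f) bd

-- Euler's relation

totalExcess : List (List ℕ) → ℕ
totalExcess L = sum (map (λ S → length S ∸ 2) L)

totalExcess-↭ : ∀ {L L′} → L ↭ L′ → totalExcess L ≡ totalExcess L′
totalExcess-↭ p = sum-↭ (Perm.map⁺ _ p)

totalExcess-++ : ∀ L L′ → totalExcess (L ++ L′) ≡ totalExcess L + totalExcess L′
totalExcess-++ L L′ = trans (cong sum (map-++ _ L L′)) (sum-++ (map _ L) (map _ L′))

totalExcess-shift : ∀ s L → totalExcess (map (map (s +_)) L) ≡ totalExcess L
totalExcess-shift s [] = refl
totalExcess-shift s (S ∷ L) = cong₂ (λ u v → u ∸ 2 + v) (length-map (s +_) S) (totalExcess-shift s L)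

dropRoof : ℕ → (Seg → Bool) → Seg → Bool
dropRoof N E p = E p ∧ not (eqSeg p (0 , N))

dropRoof-roof : ∀ {N E} → E ∋ (0 , N) → Roof E (dropRoof N E) N
dropRoof-roof {N} {E} e = roof same e absent
  where
  same : ∀ {i j} → i < j → j ≤ N → (i , j) ≢ (0 , N) → E (i , j) ≡ dropRoof N E (i , j)
  same {i} {j} _ _ ≢ with eqSeg (i , j) (0 , N) in eq
  ... | true = ⊥-elim (≢ (eqSeg⇒≡ (≡⇒T eq)))
  ... | false = sym (∧-identityʳ _)
  absent : ¬ dropRoof N E ∋ (0 , N)
  absent p rewrite T⇒≡ (eqSeg-refl (0 , N)) | ∧-zeroʳ (E (0 , N)) with p
  ... | ()

roof-sides : ∀ {N E E′} → 1 < N → Roof E E′ N → Sides N E → Sides N E′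
roof-sides 1<N (roof same _ _) sides i<N = trans (sym (same ≤-refl i<N (λ { refl → <-irrefl refl 1<N }))) (sides i<N)

-- Each face replaces the edge above it by `length S ∸ 1` edges, a gain of `length S ∸ 2`;
-- descending from the outer path through all faces ends with the `N` sides.
Euler : ℕ → Set
Euler N = ∀ {E xs} → Sides N E → NonCrossing N E → Outer E N 0 xs → N ≡ length xs + totalExcess (facesOf E N)

-- A path of at least two steps is cut into shorter intervals; for a single step, the roof is
-- removed first, which reduces to a path of at least two steps on the same interval.
euler : ∀ N → Euler N
euler = <-rec Euler body
  where
  long : ∀ N → (∀ {n} → n < N → Euler n) → ∀ {E s t xs} → Sides N E → NonCrossing N E → Outer E N 0 (s ∷ t ∷ xs) →
    N ≡ length (s ∷ t ∷ xs) + totalExcess (facesOf E N)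
  long N ih {E} {s} {t} {xs} sides nc o@(step 0<s s≤N e mx (step s<t t≤N _ _ _)) with m≤n⇒∃[o]m+o≡n s≤N
  ... | n , refl with outer-split⁻ sp o
    where sp = split {E} {E} {E ∘ shift s} {s} {n} (λ _ _ → refl) (λ _ _ → refl) (outer-gap nc o)
  ... | o₁ , y ∷ ys , refl , o₂ = begin
    s + n ≡⟨ cong₂ _+_ (ih (<-≤-trans s<t t≤N) (λ i<s → sides (<-≤-trans i<s s≤N)) (proj₁ ncs) o₁)
                       (ih (m<n+m n 0<s) (λ {i} i<n → subst (λ k → E ∋ (s + i , k)) (sym (+-suc s i)) (sides (+-monoʳ-< s i<n))) (proj₂ ncs) o₂) ⟩
    (1 + w₁) + (length (y ∷ ys) + w₂) ≡⟨ cong suc (trans (sym (+-assoc w₁ _ w₂)) (trans (cong (_+ w₂) (+-comm w₁ _)) (+-assoc _ w₁ w₂))) ⟩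
    1 + (length (y ∷ ys) + (w₁ + w₂)) ≡⟨ cong₂ (λ u v → 2 + (u + v)) (sym (length-map (s +_) ys)) (sym total) ⟩
    length (s ∷ map (s +_) (y ∷ ys)) + totalExcess (facesOf E (s + n)) ∎
    where
    open ≡-Reasoning
    sp = split {E} {E} {E ∘ shift s} {s} {n} (λ _ _ → refl) (λ _ _ → refl) (outer-gap nc o)
    ncs = split-nonCrossing⁻ sp nc
    w₁ = totalExcess (facesOf E s)
    w₂ = totalExcess (facesOf (E ∘ shift s) n)
    total : totalExcess (facesOf E (s + n)) ≡ w₁ + w₂
    total = trans (totalExcess-↭ (split-faces sp)) (trans (totalExcess-++ (facesOf E s) _) (cong (w₁ +_) (totalExcess-shift s (facesOf (E ∘ shift s) n))))
  body : ∀ N → (∀ {n} → n < N → Euler n) → Euler N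
  body .0 ih sides nc done = refl
  body N ih sides nc o@(step _ _ _ _ (step _ _ _ _ _)) = long N ih sides nc o
  -- Two vertices carry no face, so both sides compute to `1`.
  body (suc zero) ih sides nc (step _ _ _ _ done) = refl
  body (suc (suc k)) ih {E} sides nc (step _ _ e _ done) = go (proj₂ (outer-exists sides′ z≤n))
    where
    N = suc (suc k)
    rf = dropRoof-roof {N} {E} e
    sides′ = roof-sides (s≤s (s≤s z≤n)) rf sides
    nc′ = proj₁ (roof-nonCrossing rf) nc
    go : ∀ {xs} → Outer (dropRoof N E) N 0 xs → N ≡ 1 + totalExcess (facesOf E N)
    go done′ with outer-long done′ z<s (Roof.absent rf)
    go {x ∷ y ∷ xs} o | s≤s (s≤s z≤n) = trans (long N ih sides′ nc′ o) (cong suc (sym (totalExcess-↭ (roof-faces rf nc′ z<s o))))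

-- Types as sequences with finitely many nonzero entries

entry : Ty → ℕ → ℕ
entry [] k = 0
entry (x ∷ m) zero = x
entry (x ∷ m) (suc k) = entry m k

weight : ℕ → Ty → ℕ
weight d [] = 0
weight d (x ∷ m) = d * x + weight (suc d) m

mutual
  vsum≡weight : ∀ d m → _ ≡ weight d m

  Vt≡weight : ∀ m → Vt m ≡ 2 + weight 1 m
  -- Abstracting the literal leaves the private sum applied to variables only, which allows the
  -- underscore above to be solved as a function of `d` and `m`.
  Vt≡weight m with 1
  ... | d = cong (2 +_) (vsum≡weight d m)

  vsum≡weight d [] = refl
  vsum≡weight d (x ∷ m) = cong (d * x +_) (vsum≡weight (suc d) m)

mutual
  eqL⇒≡ : ∀ xs ys → _ ≡ true → xs ≡ ys

  sameTy⇒normTy≡ : ∀ a b → sameTy a b ≡ true → normTy a ≡ normTy b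
  sameTy⇒normTy≡ a b with normTy a | normTy b
  ... | xs | ys = eqL⇒≡ xs ys

  eqL⇒≡ [] [] _ = refl
  eqL⇒≡ (x ∷ xs) (y ∷ ys) p with Equivalence.to T-∧ (≡⇒T p)
  ... | q , r = cong₂ _∷_ (≡ᵇ⇒≡ x y q) (eqL⇒≡ xs ys (T⇒≡ r))

mutual
  eqL-refl : ∀ xs → _ ≡ true

  normTy≡⇒sameTy : ∀ a b → normTy a ≡ normTy b → sameTy a b ≡ true
  normTy≡⇒sameTy a b e with normTy a | normTy b
  normTy≡⇒sameTy a b refl | xs | .xs = eqL-refl xs

  eqL-refl [] = refl
  eqL-refl (x ∷ xs) = cong₂ _∧_ (≡⇒≡ᵇ′ {x} refl) (eqL-refl xs)

normTy-∷ʳ-zero : ∀ m → normTy (m ∷ʳ 0) ≡ normTy m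
normTy-∷ʳ-zero m rewrite reverse-++ m [ 0 ] = refl

normTy-∷ʳ-suc : ∀ m x → normTy (m ∷ʳ suc x) ≡ m ∷ʳ suc x
normTy-∷ʳ-suc m x rewrite reverse-++ m [ suc x ] = trans (unfold-reverse (suc x) (reverse m)) (cong (_∷ʳ suc x) (reverse-involutive m))

entry-∷ʳ-zero : ∀ m k → entry (m ∷ʳ 0) k ≡ entry m k
entry-∷ʳ-zero [] zero = refl
entry-∷ʳ-zero [] (suc k) = refl
entry-∷ʳ-zero (x ∷ m) zero = refl
entry-∷ʳ-zero (x ∷ m) (suc k) = entry-∷ʳ-zero m k

EndsNonZero : Ty → Set
EndsNonZero [] = ⊤
EndsNonZero (x ∷ []) = x ≢ 0
EndsNonZero (x ∷ y ∷ m) = EndsNonZero (y ∷ m)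

endsNonZero-∷ʳ-suc : ∀ m x → EndsNonZero (m ∷ʳ suc x)
endsNonZero-∷ʳ-suc [] x ()
endsNonZero-∷ʳ-suc (_ ∷ []) x ()
endsNonZero-∷ʳ-suc (_ ∷ y ∷ m) x = endsNonZero-∷ʳ-suc (y ∷ m) x

-- The induction runs from the right end, where `normTy` strips zeros.
normTy-spec : ∀ {m} → Reverse m → EndsNonZero (normTy m) × (∀ k → entry (normTy m) k ≡ entry m k)
normTy-spec [] = tt , λ _ → refl
normTy-spec (m ∶ rs ∶ʳ zero) rewrite normTy-∷ʳ-zero m with normTy-spec rs
... | e , f = e , λ k → trans (f k) (sym (entry-∷ʳ-zero m k))
normTy-spec (m ∶ rs ∶ʳ suc x) rewrite normTy-∷ʳ-suc m x = endsNonZero-∷ʳ-suc m x , λ _ → refl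

endsNonZero-tail : ∀ x m → EndsNonZero (x ∷ m) → EndsNonZero m
endsNonZero-tail x [] _ = tt
endsNonZero-tail x (y ∷ m) e = e

zero-entries : ∀ m → EndsNonZero m → (∀ k → entry m k ≡ 0) → m ≡ []
zero-entries [] _ _ = refl
zero-entries (x ∷ []) e z = ⊥-elim (e (z 0))
zero-entries (x ∷ y ∷ m) e z with zero-entries (y ∷ m) e (z ∘ suc)
... | ()

-- Trailing zeros are the only freedom in representing a sequence by a list; hence `sameTy` decides
-- equality of sequences.
entries-injective : ∀ a b → EndsNonZero a → EndsNonZero b → (∀ k → entry a k ≡ entry b k) → a ≡ b
entries-injective [] b _ eb eq = sym (zero-entries b eb (sym ∘ eq))
entries-injective (x ∷ a) [] ea _ eq = zero-entries (x ∷ a) ea eq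
entries-injective (x ∷ a) (y ∷ b) ea eb eq =
  cong₂ _∷_ (eq 0) (entries-injective a b (endsNonZero-tail x a ea) (endsNonZero-tail y b eb) (eq ∘ suc))

sameTy⁻ : ∀ a b → sameTy a b ≡ true → ∀ k → entry a k ≡ entry b k
sameTy⁻ a b p k = trans (sym (proj₂ (normTy-spec (reverseView a)) k))
  (trans (cong (λ m → entry m k) (sameTy⇒normTy≡ a b p)) (proj₂ (normTy-spec (reverseView b)) k))

sameTy⁺ : ∀ a b → (∀ k → entry a k ≡ entry b k) → sameTy a b ≡ true
sameTy⁺ a b eq with normTy-spec (reverseView a) | normTy-spec (reverseView b)
... | ea , fa | eb , fb = normTy≡⇒sameTy a b (entries-injective _ _ ea eb (λ k → trans (fa k) (trans (eq k) (sym (fb k)))))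

entry-⊕ : ∀ a b k → entry (a ⊕ b) k ≡ entry a k + entry b k
entry-⊕ [] b k = refl
entry-⊕ (x ∷ a) [] k = sym (+-identityʳ _)
entry-⊕ (x ∷ a) (y ∷ b) zero = refl
entry-⊕ (x ∷ a) (y ∷ b) (suc k) = entry-⊕ a b k

indicator : Bool → ℕ
indicator b = if b then 1 else 0

-- The unit sits at index `r ∸ 2`, the index counting faces with `suc r` vertices. The indicator has
-- the form in which `countSize-∷` produces it for such a face.
entry-unitTy : ∀ r k → 2 ≤ r → entry (unitTy r) k ≡ indicator (suc r ≡ᵇ 3 + k)
entry-unitTy (suc (suc r)) k _ = go r k
  where
  go : ∀ r k → entry (replicate r 0 ++ [ 1 ]) k ≡ indicator (r ≡ᵇ k)
  go zero zero = refl
  go zero (suc k) = refl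
  go (suc r) zero = refl
  go (suc r) (suc k) = go r k
entry-unitTy (suc zero) k (s≤s ())

-- `zipWith` truncates to the shorter list, hence the condition on lengths, which all members of
-- `below m` satisfy.
entry-zipWith-∸ : ∀ m n k → length n ≡ length m → entry (zipWith _∸_ m n) k ≡ entry m k ∸ entry n k
entry-zipWith-∸ [] [] k _ = refl
entry-zipWith-∸ (x ∷ m) (y ∷ n) zero _ = refl
entry-zipWith-∸ (x ∷ m) (y ∷ n) (suc k) eq = entry-zipWith-∸ m n k (suc-injective eq)

isZeroTy⁻ : ∀ m → isZeroTy m ≡ true → ∀ k → entry m k ≡ 0
isZeroTy⁻ [] _ k = refl
isZeroTy⁻ (zero ∷ m) p zero = refl
isZeroTy⁻ (zero ∷ m) p (suc k) = isZeroTy⁻ m p k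

isZeroTy⁺ : ∀ m → (∀ k → entry m k ≡ 0) → isZeroTy m ≡ true
isZeroTy⁺ [] _ = refl
isZeroTy⁺ (x ∷ m) z rewrite z 0 = isZeroTy⁺ m (z ∘ suc)

concatMap-map : ∀ {A B C : Set} (f : A → B → C) xs ys → concatMap (λ x → map (f x) ys) xs ≡ cartesianProductWith f xs ys
concatMap-map f [] ys = refl
concatMap-map f (x ∷ xs) ys = cong (map (f x) ys ++_) (concatMap-map f xs ys)

below-∷ : ∀ x m → below (x ∷ m) ≡ cartesianProductWith _∷_ (upTo (suc x)) (below m)
below-∷ x m = concatMap-map _∷_ (upTo (suc x)) (below m)

below⁻ : ∀ m {n} → n ∈ below m → length n ≡ length m × (∀ k → entry n k ≤ entry m k)
below⁻ [] (here refl) = refl , λ _ → z≤n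
below⁻ (x ∷ m) n∈ with ∈-cartesianProductWith⁻ _∷_ (upTo (suc x)) (below m) (subst (_ ∈_) (below-∷ x m) n∈)
... | y , n′ , y∈ , n′∈ , refl with below⁻ m n′∈
... | len , le = cong suc len , λ { zero → s≤s⁻¹ (∈-upTo⁻ y∈) ; (suc k) → le k }

below⁺ : ∀ m {n} → length n ≡ length m → (∀ k → entry n k ≤ entry m k) → n ∈ below m
below⁺ [] {[]} _ _ = here refl
below⁺ (x ∷ m) {y ∷ n} len le = subst (_ ∈_) (sym (below-∷ x m))
  (∈-cartesianProductWith⁺ _∷_ (∈-upTo⁺ (s≤s (le 0))) (below⁺ m (suc-injective len) (le ∘ suc)))

unique-below : ∀ m → Unique (below m)
unique-below [] = [] ∷ []
unique-below (x ∷ m) = subst Unique (sym (below-∷ x m))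
  (Unique.cartesianProductWith⁺ _∷_ (λ { refl → refl , refl }) (Unique.upTo⁺ (suc x)) (unique-below m))

sameLength-entries : ∀ a b → length a ≡ length b → (∀ k → entry a k ≡ entry b k) → a ≡ b
sameLength-entries [] [] _ _ = refl
sameLength-entries (x ∷ a) (y ∷ b) len eq = cong₂ _∷_ (eq 0) (sameLength-entries a b (suc-injective len) (eq ∘ suc))

-- The length of `m` is imposed because `below m` holds only lists of that length, one
-- representative for each type bounded by `m`.
restrict : Ty → (ℕ → ℕ) → Ty
restrict [] f = []
restrict (_ ∷ m) f = f 0 ∷ restrict m (f ∘ suc)

length-restrict : ∀ m f → length (restrict m f) ≡ length m
length-restrict [] f = refl
length-restrict (_ ∷ m) f = cong suc (length-restrict m (f ∘ suc))

entry-restrict : ∀ m f → (∀ k → f k ≤ entry m k) → ∀ k → entry (restrict m f) k ≡ f k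
entry-restrict [] f le k = sym (n≤0⇒n≡0 (le k))
entry-restrict (_ ∷ m) f le zero = refl
entry-restrict (_ ∷ m) f le (suc k) = entry-restrict m (f ∘ suc) (le ∘ suc) k

-- Types of families of faces

countSize : ℕ → List (List ℕ) → ℕ
countSize k L = length (filterᵇ (λ S → length S ≡ᵇ k) L)

countSize-∷ : ∀ k S L → countSize k (S ∷ L) ≡ indicator (length S ≡ᵇ k) + countSize k L
countSize-∷ k S L with length S ≡ᵇ k
... | true  = refl
... | false = refl

countSize-↭ : ∀ k {L L′} → L ↭ L′ → countSize k L ≡ countSize k L′
countSize-↭ k p = ↭-length (Perm.filter-↭ _ p)

countSize-++ : ∀ k L L′ → countSize k (L ++ L′) ≡ countSize k L + countSize k L′
countSize-++ k L L′ = trans (cong length (filter-++ _ L L′)) (length-++ (filterᵇ _ L))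

countSize-shift : ∀ k s L → countSize k (map (map (s +_)) L) ≡ countSize k L
countSize-shift k s [] = refl
countSize-shift k s (S ∷ L) = begin
  countSize k (map (s +_) S ∷ map (map (s +_)) L) ≡⟨ countSize-∷ k (map (s +_) S) _ ⟩
  indicator (length (map (s +_) S) ≡ᵇ k) + countSize k (map (map (s +_)) L)
    ≡⟨ cong₂ (λ l c → indicator (l ≡ᵇ k) + c) (length-map (s +_) S) (countSize-shift k s L) ⟩
  indicator (length S ≡ᵇ k) + countSize k L ≡⟨ countSize-∷ k S L ⟨
  countSize k (S ∷ L) ∎
  where open ≡-Reasoning

-- Position `k` of a type stands for `m_{k+2}`, which counts polygons with `k + 3` vertices.
HasType : List (List ℕ) → Ty → Set
HasType L m = ∀ k → countSize (3 + k) L ≡ entry m k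

Long : List (List ℕ) → Set
Long L = ∀ {S} → S ∈ L → 3 ≤ length S

module Weights where

  count : ℕ → List ℕ → ℕ
  count k L = length (filterᵇ (_≡ᵇ k) L)

  -- This mirrors passing from a type to its tail: the smallest faces are discarded and all others
  -- move down by one size, while the weight `d` per face goes up by one to compensate. It turns a
  -- sum over faces into a sum over sizes.
  lower : List ℕ → List ℕ
  lower [] = []
  lower (zero ∷ L) = lower L
  lower (suc x ∷ L) = x ∷ lower L

  count-lower : ∀ k L → count k (lower L) ≡ count (suc k) L
  count-lower k [] = refl
  count-lower k (zero ∷ L) = count-lower k L
  count-lower k (suc x ∷ L) with x ≡ᵇ k
  ... | true = cong suc (count-lower k L)
  ... | false = count-lower k L

  sum-lower : ∀ d L → sum (map (d +_) L) ≡ d * count 0 L + sum (map (suc d +_) (lower L))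
  sum-lower d [] = cong (_+ 0) (sym (*-zeroʳ d))
  sum-lower d (zero ∷ L) rewrite +-identityʳ d | *-suc d (count 0 L) | sum-lower d L = sym (+-assoc d _ _)
  sum-lower d (suc x ∷ L) rewrite sum-lower d L | +-suc d x = begin
    suc (d + x) + (c + u) ≡⟨ +-assoc (suc (d + x)) c u ⟨
    suc (d + x) + c + u ≡⟨ cong (_+ u) (+-comm (suc (d + x)) c) ⟩
    c + suc (d + x) + u ≡⟨ +-assoc c _ u ⟩
    c + (suc (d + x) + u) ∎
    where
    open ≡-Reasoning
    c = d * count 0 L
    u = sum (map (suc d +_) (lower L))

  no-entries : ∀ L → (∀ k → count k L ≡ 0) → L ≡ []
  no-entries [] _ = refl
  no-entries (x ∷ L) z with z x
  ... | p rewrite ≡⇒≡ᵇ′ {x} refl with p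
  ... | ()

  sum-weight : ∀ d m L → (∀ k → count k L ≡ entry m k) → sum (map (d +_) L) ≡ weight d m
  sum-weight d [] L z rewrite no-entries L z = refl
  sum-weight d (c ∷ m) L z = trans (sum-lower d L) (cong₂ _+_ (cong (d *_) (z 0))
    (sum-weight (suc d) m (lower L) (λ k → trans (count-lower k L) (z (suc k)))))

  count-sizes : ∀ k L → Long L → count k (map (λ S → length S ∸ 3) L) ≡ countSize (3 + k) L
  count-sizes k [] _ = refl
  count-sizes k (S ∷ L) lng with lng (here refl)
  count-sizes k ((_ ∷ _ ∷ _ ∷ S) ∷ L) lng | s≤s (s≤s (s≤s z≤n)) with length S ≡ᵇ k
  ... | true = cong suc (count-sizes k L (lng ∘ there))
  ... | false = count-sizes k L (lng ∘ there)

  sum-sizes : ∀ L → Long L → sum (map (1 +_) (map (λ S → length S ∸ 3) L)) ≡ totalExcess L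
  sum-sizes [] _ = refl
  sum-sizes (S ∷ L) lng with lng (here refl)
  sum-sizes ((_ ∷ _ ∷ _ ∷ S) ∷ L) lng | s≤s (s≤s (s≤s z≤n)) = cong (suc (length S) +_) (sum-sizes L (lng ∘ there))

totalExcess≡weight : ∀ {m L} → Long L → HasType L m → totalExcess L ≡ weight 1 m
totalExcess≡weight {m} {L} lng ty = trans (sym (sum-sizes L lng))
  (sum-weight 1 m (map (λ S → length S ∸ 3) L) (λ k → trans (count-sizes k L lng) (ty k)))
  where open Weights

length-subs : ∀ {A : Set} (xs : List A) {ys} → ys ∈ subs xs → length ys ≤ length xs
length-subs [] (here refl) = z≤n
length-subs (x ∷ xs) p with ∈-++⁻ (map (x ∷_) (subs xs)) p
... | inj₂ q = m≤n⇒m≤1+n (length-subs xs q)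
... | inj₁ q with ∈-map⁻ (x ∷_) q
... | zs , zs∈ , refl = s≤s (length-subs xs zs∈)

-- A face has at most `suc N` vertices, so the sizes beyond the end of the list `typeOf` do not
-- occur.
countSize-large : ∀ E N {k} → suc N < k → countSize k (facesOf E N) ≡ 0
countSize-large E N {k} N<k = go (facesOf E N) λ {S} S∈ →
  subst (length S ≤_) (length-upTo (suc N)) (length-subs (upTo (suc N)) (proj₁ (∈-filterᵇ⁻ (isFaceOf E) {xs = subs (upTo (suc N))} S∈)))
  where
  go : ∀ L → (∀ {S} → S ∈ L → length S ≤ suc N) → countSize k L ≡ 0
  go [] _ = refl
  go (S ∷ L) bd with length S ≡ᵇ k in eq
  ... | true = ⊥-elim (<⇒≱ N<k (subst (_≤ suc N) (≡ᵇ⇒≡′ {length S} eq) (bd (here refl))))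
  ... | false = go L (bd ∘ there)

-- The function `h` is general because the recursion replaces it by `h ∘ suc`; `upTo` is the case
-- `id`.
entry-map-upTo : ∀ (f g h : ℕ → ℕ) n → (∀ {k} → n ≤ k → f (g (h k)) ≡ 0) →
  ∀ k → entry (map f (map g (applyUpTo h n))) k ≡ f (g (h k))
entry-map-upTo f g h zero z k = sym (z z≤n)
entry-map-upTo f g h (suc n) z zero = refl
entry-map-upTo f g h (suc n) z (suc k) = entry-map-upTo f g (h ∘ suc) n (z ∘ s≤s) k

entry-typeOf : ∀ N D k → entry (typeOf (suc N) D) k ≡ countSize (3 + k) (facesOf (isEdge (suc N) D) N)
entry-typeOf N D = entry-map-upTo (λ k → countSize (suc k) (facesOf (isEdge (suc N) D) N)) (2 +_) id N
  (λ N≤k → countSize-large (isEdge (suc N) D) N (s≤s (s≤s (m≤n⇒m≤1+n N≤k))))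

-- Chord lists realising edge predicates

Sys : Set
Sys = ℕ × List Seg

edge : List Seg → Seg → Bool
edge D (i , j) = (j ≡ᵇ suc i) ∨ elemSeg (i , j) D

∨-true⁻ : ∀ {a b} → a ∨ b ≡ true → a ≡ true ⊎ b ≡ true
∨-true⁻ {true} _ = inj₁ refl
∨-true⁻ {false} p = inj₂ p

∨-trueʳ : ∀ a {b} → b ≡ true → a ∨ b ≡ true
∨-trueʳ true _ = refl
∨-trueʳ false p = p

∧-true⁻ : ∀ {a b} → a ∧ b ≡ true → a ≡ true × b ≡ true
∧-true⁻ {true} p = refl , p

edge⁻ : ∀ D i j → edge D ∋ (i , j) → j ≡ suc i ⊎ (i , j) ∈ D
edge⁻ D i j p = Sum.map (≡ᵇ⇒≡′ {j}) elemSeg⇒∈ (∨-true⁻ p)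

edge-side : ∀ D i → edge D ∋ (i , suc i)
edge-side D i rewrite ≡⇒≡ᵇ′ {suc i} refl = refl

edge-∈ : ∀ {D i j} → (i , j) ∈ D → edge D ∋ (i , j)
edge-∈ {i = i} {j} p∈ = ∨-trueʳ (j ≡ᵇ suc i) (∈⇒elemSeg p∈)

grid : ℕ → List Seg
grid V = concatMap (λ i → map (i ,_) (upTo V)) (upTo V)

grid≡ : ∀ V → grid V ≡ cartesianProduct (upTo V) (upTo V)
grid≡ V = concatMap-map _,_ (upTo V) (upTo V)

unique-grid : ∀ V → Unique (grid V)
unique-grid V = subst Unique (sym (grid≡ V)) (Unique.cartesianProduct⁺ (Unique.upTo⁺ V) (Unique.upTo⁺ V))

grid⁺ : ∀ {V i j} → i < V → j < V → (i , j) ∈ grid V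
grid⁺ {V} i< j< = subst (_ ∈_) (sym (grid≡ V)) (∈-cartesianProduct⁺ (∈-upTo⁺ i<) (∈-upTo⁺ j<))

grid⁻ : ∀ {V i j} → (i , j) ∈ grid V → j < V
grid⁻ {V} p∈ = ∈-upTo⁻ (proj₂ (∈-cartesianProduct⁻ (upTo V) (upTo V) (subst (_ ∈_) (grid≡ V) p∈)))

isArc : Seg → Bool
isArc (i , j) = suc i <ᵇ j

-- For `N ≥ 2` these are the diagonals together with the roof, so a system can state by membership
-- whether it has its roof.
arcs : ℕ → List Seg
arcs N = filterᵇ isArc (grid (suc N))

unique-arcs : ∀ N → Unique (arcs N)
unique-arcs N = unique-filterᵇ isArc (unique-grid (suc N))

arcs⁺ : ∀ {N i j} → suc i < j → j ≤ N → (i , j) ∈ arcs N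
arcs⁺ i<j j≤N = ∈-filterᵇ⁺ isArc (grid⁺ (<-trans (<-trans ≤-refl i<j) (s≤s j≤N)) (s≤s j≤N)) (T⇒≡ (<⇒<ᵇ i<j))

arcs⁻ : ∀ {N i j} → (i , j) ∈ arcs N → suc i < j × j ≤ N
arcs⁻ {N} {i} {j} p∈ with ∈-filterᵇ⁻ isArc {xs = grid (suc N)} p∈
... | g , a = <ᵇ⇒< (suc i) j (≡⇒T a) , s≤s⁻¹ (grid⁻ {suc N} g)

ArcSet : ℕ → List Seg → Set
ArcSet N D = D ∈ subs (arcs N)

-- Filtering the fixed enumeration by `E` gives a canonical list. Constructions can thus be made on
-- predicates and converted to lists at the end.
realise : ∀ N E → Sides N E → ∃[ D ] ArcSet N D × Agree N (edge D) E
realise N E sides = D , filterᵇ∈subs E (arcs N) , λ i<j j≤N → bool-ext (fwd j≤N) (bwd i<j j≤N)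
  where
  D = filterᵇ E (arcs N)
  fwd : ∀ {i j} → j ≤ N → edge D ∋ (i , j) → E ∋ (i , j)
  fwd {i} {j} j≤N p with edge⁻ D i j p
  ... | inj₁ refl = sides j≤N
  ... | inj₂ p∈ = proj₂ (∈-filterᵇ⁻ E {xs = arcs N} p∈)
  bwd : ∀ {i j} → i < j → j ≤ N → E ∋ (i , j) → edge D ∋ (i , j)
  bwd {i} {j} i<j j≤N e with m≤n⇒m<n∨m≡n i<j
  ... | inj₂ refl = edge-side D i
  ... | inj₁ si<j = edge-∈ (∈-filterᵇ⁺ E (arcs⁺ si<j j≤N) e)

edge-injective : ∀ {N D D′} → ArcSet N D → ArcSet N D′ → Agree N (edge D) (edge D′) → D ≡ D′
edge-injective {N} p q ag = subs-extensional (unique-arcs N) p q (go p ag) (go q (agree-sym ag))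
  where
  go : ∀ {D D′ x} → ArcSet N D → Agree N (edge D) (edge D′) → x ∈ D → x ∈ D′
  go {D} {D′} {i , j} p ag x∈ with arcs⁻ (subs-⊆ p x∈)
  ... | si<j , j≤N with edge⁻ D′ i j (trans (sym (ag (<-trans ≤-refl si<j) j≤N)) (edge-∈ x∈))
  ... | inj₁ refl = ⊥-elim (<-irrefl refl si<j)
  ... | inj₂ x∈′ = x∈′

-- Diagonals and crossings of the polygon

isEdge⁻ : ∀ N D i j → isEdge (suc N) D ∋ (i , j) → j ≡ suc i ⊎ ((i , j) ≡ (0 , N) ⊎ (i , j) ∈ D)
isEdge⁻ N D i j p with ∨-true⁻ {isSide (suc N) (i , j)} p
... | inj₂ q = inj₂ (inj₂ (elemSeg⇒∈ q))
... | inj₁ q with ∨-true⁻ {j ≡ᵇ suc i} q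
... | inj₁ e = inj₁ (≡ᵇ⇒≡′ {j} e)
... | inj₂ e with ∧-true⁻ {i ≡ᵇ 0} e
... | e₁ , e₂ = inj₂ (inj₁ (cong₂ _,_ (≡ᵇ⇒≡′ {i} e₁) (≡ᵇ⇒≡′ {j} e₂)))

isEdge-side : ∀ N D i → isEdge (suc N) D ∋ (i , suc i)
isEdge-side N D i rewrite ≡⇒≡ᵇ′ {suc i} refl = refl

isEdge-roof : ∀ N D → isEdge (suc N) D ∋ (0 , N)
isEdge-roof N D rewrite ≡⇒≡ᵇ′ {N} refl | ∨-zeroʳ (N ≡ᵇ 1) = refl

isEdge-∈ : ∀ N {D i j} → (i , j) ∈ D → isEdge (suc N) D ∋ (i , j)
isEdge-∈ N {i = i} {j} p∈ = ∨-trueʳ (isSide (suc N) (i , j)) (∈⇒elemSeg p∈)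

isDiagonal⁻ : ∀ {N i j} → isDiagonal (suc N) (i , j) ≡ true → suc i < j × (i , j) ≢ (0 , N)
isDiagonal⁻ {N} {i} {j} p with ∧-true⁻ {suc i <ᵇ j} p
... | a , q with ∧-true⁻ {j <ᵇ suc N} q
... | b , c = <ᵇ⇒< (suc i) j (≡⇒T a) , λ { refl → not-roof c }
  where
  not-roof : not (N ≡ᵇ N) ≢ true
  not-roof c rewrite ≡⇒≡ᵇ′ {N} refl with c
  ... | ()

isDiagonal⁺ : ∀ {N i j} → suc i < j → j ≤ N → (i , j) ≢ (0 , N) → isDiagonal (suc N) (i , j) ≡ true
isDiagonal⁺ {N} {i} {j} si<j j≤N ≢ rewrite T⇒≡ (<⇒<ᵇ si<j) | T⇒≡ (<⇒<ᵇ (s≤s j≤N)) with (i ≡ᵇ 0) ∧ (j ≡ᵇ N) in eq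
... | false = refl
... | true with ∧-true⁻ {i ≡ᵇ 0} eq
... | a , b = ⊥-elim (≢ (cong₂ _,_ (≡ᵇ⇒≡′ {i} a) (≡ᵇ⇒≡′ {j} b)))

diagonals⁻ : ∀ {N i j} → (i , j) ∈ allDiagonals (suc N) → suc i < j × j ≤ N × (i , j) ≢ (0 , N)
diagonals⁻ {N} p∈ with ∈-filterᵇ⁻ (isDiagonal (suc N)) {xs = grid (suc N)} p∈
... | g , d = let a , b = isDiagonal⁻ d in a , s≤s⁻¹ (grid⁻ {suc N} g) , b

diagonals⁺ : ∀ {N i j} → suc i < j → j ≤ N → (i , j) ≢ (0 , N) → (i , j) ∈ allDiagonals (suc N)
diagonals⁺ {N} si<j j≤N ≢ = ∈-filterᵇ⁺ (isDiagonal (suc N))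
  (grid⁺ (<-trans (<-trans ≤-refl si<j) (s≤s j≤N)) (s≤s j≤N)) (isDiagonal⁺ si<j j≤N ≢)

unique-diagonals : ∀ N → Unique (allDiagonals (suc N))
unique-diagonals N = unique-filterᵇ (isDiagonal (suc N)) (unique-grid (suc N))

DiagonalSet : ℕ → List Seg → Set
DiagonalSet N D = D ∈ subs (allDiagonals (suc N))

realiseDiagonals : ∀ N E → Sides N E → E ∋ (0 , N) → ∃[ D ] DiagonalSet N D × Agree N (isEdge (suc N) D) E
realiseDiagonals N E sides top = D , filterᵇ∈subs E (allDiagonals (suc N)) , λ i<j j≤N → bool-ext (fwd j≤N) (bwd i<j j≤N)
  where
  D = filterᵇ E (allDiagonals (suc N))
  fwd : ∀ {i j} → j ≤ N → isEdge (suc N) D ∋ (i , j) → E ∋ (i , j)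
  fwd {i} {j} j≤N p with isEdge⁻ N D i j p
  ... | inj₁ refl = sides j≤N
  ... | inj₂ (inj₁ refl) = top
  ... | inj₂ (inj₂ p∈) = proj₂ (∈-filterᵇ⁻ E {xs = allDiagonals (suc N)} p∈)
  bwd : ∀ {i j} → i < j → j ≤ N → E ∋ (i , j) → isEdge (suc N) D ∋ (i , j)
  bwd {i} {j} i<j j≤N e with m≤n⇒m<n∨m≡n i<j | i ≟ 0 | j ≟ N
  ... | inj₂ refl | _ | _ = isEdge-side N D i
  ... | inj₁ _ | yes refl | yes refl = isEdge-roof N D
  ... | inj₁ si<j | no i≢ | _ = isEdge-∈ N (∈-filterᵇ⁺ E (diagonals⁺ si<j j≤N (i≢ ∘ cong proj₁)) e)
  ... | inj₁ si<j | yes _ | no j≢ = isEdge-∈ N (∈-filterᵇ⁺ E (diagonals⁺ si<j j≤N (j≢ ∘ cong proj₂)) e)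

isEdge-injective : ∀ {N D D′} → DiagonalSet N D → DiagonalSet N D′ → Agree N (isEdge (suc N) D) (isEdge (suc N) D′) → D ≡ D′
isEdge-injective {N} p q ag = subs-extensional (unique-diagonals N) p q (go p ag) (go q (agree-sym ag))
  where
  go : ∀ {D D′ x} → DiagonalSet N D → Agree N (isEdge (suc N) D) (isEdge (suc N) D′) → x ∈ D → x ∈ D′
  go {D} {D′} {i , j} p ag x∈ with diagonals⁻ (subs-⊆ p x∈)
  ... | si<j , j≤N , ≢ with isEdge⁻ N D′ i j (trans (sym (ag (<-trans ≤-refl si<j) j≤N)) (isEdge-∈ N x∈))
  ... | inj₁ refl = ⊥-elim (<-irrefl refl si<j)
  ... | inj₂ (inj₁ e) = ⊥-elim (≢ e)
  ... | inj₂ (inj₂ x∈′) = x∈′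

between⁺ : ∀ {a b c d} → a < b → b < c → c < d → (a <ᵇ b) ∧ (b <ᵇ c) ∧ (c <ᵇ d) ≡ true
between⁺ p q r rewrite T⇒≡ (<⇒<ᵇ p) | T⇒≡ (<⇒<ᵇ q) | T⇒≡ (<⇒<ᵇ r) = refl

between⁻ : ∀ a b c d → (a <ᵇ b) ∧ (b <ᵇ c) ∧ (c <ᵇ d) ≡ true → a < b × b < c × c < d
between⁻ a b c d p with ∧-true⁻ {a <ᵇ b} p
... | x , q with ∧-true⁻ {b <ᵇ c} q
... | y , z = <ᵇ⇒< a b (≡⇒T x) , <ᵇ⇒< b c (≡⇒T y) , <ᵇ⇒< c d (≡⇒T z)

-- Sides and the roof cross nothing. Two diagonals may occur in `pairs D` in either order, and the
-- two disjuncts of `crosses` cover both.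
nonCrossing⁻ : ∀ {N D} → nonCrossing D ≡ true → NonCrossing N (isEdge (suc N) D)
nonCrossing⁻ {N} {D} nc {a} {b} {c} {d} a<c c<b b<d d≤N ab cd with isEdge⁻ N D a b ab | isEdge⁻ N D c d cd
... | inj₁ refl | _ = <⇒≱ a<c (s≤s⁻¹ c<b)
... | inj₂ (inj₁ refl) | _ = <⇒≱ b<d d≤N
... | inj₂ (inj₂ _) | inj₁ refl = <⇒≱ c<b (s≤s⁻¹ b<d)
... | inj₂ (inj₂ _) | inj₂ (inj₁ refl) = n≮0 a<c
... | inj₂ (inj₂ ab∈) | inj₂ (inj₂ cd∈) with pairs⁺ ab∈ cd∈
... | inj₁ refl = <-irrefl refl a<c
... | inj₂ (inj₁ p) = refute (All.lookup (all⁺ _ (pairs D) (≡⇒T nc)) p)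
  where
  refute : ¬ T (not (crosses (a , b) (c , d)))
  refute t rewrite between⁺ a<c c<b b<d = t
... | inj₂ (inj₂ p) = refute (All.lookup (all⁺ _ (pairs D) (≡⇒T nc)) p)
  where
  refute : ¬ T (not (crosses (c , d) (a , b)))
  refute t rewrite between⁺ a<c c<b b<d | ∨-zeroʳ ((c <ᵇ a) ∧ (a <ᵇ d) ∧ (d <ᵇ b)) = t

nonCrossing⁺ : ∀ {N D} → DiagonalSet N D → NonCrossing N (isEdge (suc N) D) → nonCrossing D ≡ true
nonCrossing⁺ {N} {D} D∈ nc = T⇒≡ (all⁻ _ (All.tabulate ok))
  where
  bound : ∀ {i j} → (i , j) ∈ D → j ≤ N
  bound p∈ = proj₁ (proj₂ (diagonals⁻ (subs-⊆ D∈ p∈)))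
  ok : ∀ {st} → st ∈ pairs D → T (not (crosses (proj₁ st) (proj₂ st)))
  ok {(a , b) , (c , d)} st∈ with crosses (a , b) (c , d) in eq
  ... | false = _
  ... | true with pairs⁻ st∈ | ∨-true⁻ {(a <ᵇ c) ∧ (c <ᵇ b) ∧ (b <ᵇ d)} eq
  ... | s∈ , t∈ | inj₁ x = let p , q , r = between⁻ a c b d x in nc p q r (bound t∈) (isEdge-∈ N s∈) (isEdge-∈ N t∈)
  ... | s∈ , t∈ | inj₂ y = let p , q , r = between⁻ c a d b y in nc p q r (bound s∈) (isEdge-∈ N t∈) (isEdge-∈ N s∈)

-- The roof is an edge only if it belongs to D, unlike in isEdge.
record System (r : ℕ) (m : Ty) (x : Sys) : Set where
  constructor system
  N = proj₁ x
  D = proj₂ x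
  field
    arcSet      : ArcSet N D
    noCrossing  : NonCrossing N (edge D)
    path        : List ℕ
    outer       : Outer (edge D) N 0 path
    pathLength  : length path ≡ r
    hasType     : HasType (facesOf (edge D) N) m

hasType-cong : ∀ {N E E′ m} → Agree N E E′ → HasType (facesOf E N) m → HasType (facesOf E′ N) m
hasType-cong {N} {E} {E′} {m} ag = subst (λ L → HasType L m) (facesOf-cong ag)

long-facesOf : ∀ E N → Long (facesOf E N)
long-facesOf E N S∈ = Face.long (proj₁ (facesOf⁻ {E} {N} S∈))

edge-sides : ∀ D N → Sides N (edge D)
edge-sides D N {i} _ = edge-side D i

-- For `r = 1` the value is one less than `Vt m`: the vertex count left free by a system is the one
-- prescribed for a subdigon.
system-size : ∀ {r m x} → System r m x → proj₁ x ≡ r + weight 1 m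
system-size {m = m} {N , D} (system _ nc xs o refl ty) = trans (euler N (edge-sides D N) nc o)
  (cong (length xs +_) (totalExcess≡weight {m} (long-facesOf (edge D) N) ty))

outer-roof : ∀ {E N} → 0 < N → E ∋ (0 , N) → Outer E N 0 [ N ]
outer-roof 0<N e = step 0<N ≤-refl e (λ N<j j≤N _ → <⇒≱ N<j j≤N) done

system₁-roof : ∀ {m N D} → System 1 m (N , D) → 0 < N × edge D ∋ (0 , N)
system₁-roof (system _ _ _ (step 0<s _ e _ done) _ _) = 0<s , e

-- Subdigons

Central : ℕ → (Seg → Bool) → ℕ → Set
Central r E N = ∃[ S ] S ∈ facesOf E N × 0 ∈ S × N ∈ S × length S ≡ suc r

central-cong : ∀ {r N E E′} → Agree N E E′ → Central r E N → Central r E′ N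
central-cong ag (S , S∈ , q) = S , subst (S ∈_) (facesOf-cong ag) S∈ , q

centralIs⁻ : ∀ r N D → centralIs r (suc N) D ≡ true → Central r (isEdge (suc N) D) N
centralIs⁻ r N D p with find (any⁻ _ (facesOf (isEdge (suc N) D) N) (≡⇒T p))
... | S , S∈ , t with ∧-true⁻ {elemℕ 0 S} (T⇒≡ t)
... | a , q with ∧-true⁻ {elemℕ N S} q
... | b , c = S , S∈ , elemℕ⇒∈ a , elemℕ⇒∈ b , ≡ᵇ⇒≡′ {length S} c

centralIs⁺ : ∀ r N D → Central r (isEdge (suc N) D) N → centralIs r (suc N) D ≡ true
centralIs⁺ r N D (S , S∈ , 0∈ , N∈ , len) = T⇒≡ (any⁺ _ (lose S∈ (≡⇒T ok)))
  where
  ok : elemℕ 0 S ∧ elemℕ N S ∧ (length S ≡ᵇ suc r) ≡ true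
  ok rewrite ∈⇒elemℕ 0∈ | ∈⇒elemℕ N∈ = ≡⇒≡ᵇ′ {length S} len

record Subdigon (N : ℕ) (m : Ty) (D : List Seg) : Set where
  constructor subdigon
  field
    diagonalSet : DiagonalSet N D
    noCrossing  : NonCrossing N (isEdge (suc N) D)
    hasType     : HasType (facesOf (isEdge (suc N) D) N) m

isSubdigon : ℕ → Ty → List Seg → Bool
isSubdigon V m D = nonCrossing D ∧ sameTy (typeOf V D) m

-- The number of vertices is a separate argument so that `Vt m` can be rewritten to
-- `2 + weight 1 m`, whose successor form the lemmas on `suc N` vertices need.
subdigonsOn : ℕ → Ty → List (List Seg)
subdigonsOn V m = filterᵇ (isSubdigon V m) (subs (allDiagonals V))

subdigonsOn⁻ : ∀ {N m D} → D ∈ subdigonsOn (suc N) m → Subdigon N m D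
subdigonsOn⁻ {N} {m} {D} D∈ with ∈-filterᵇ⁻ (isSubdigon (suc N) m) {xs = subs (allDiagonals (suc N))} D∈
... | D∈′ , p with ∧-true⁻ {nonCrossing D} p
... | nc , ty = subdigon D∈′ (nonCrossing⁻ {N} {D} nc) (λ k → trans (sym (entry-typeOf N D k)) (sameTy⁻ (typeOf (suc N) D) m ty k))

subdigonsOn⁺ : ∀ {N m D} → Subdigon N m D → D ∈ subdigonsOn (suc N) m
subdigonsOn⁺ {N} {m} {D} (subdigon D∈ nc ty) = ∈-filterᵇ⁺ (isSubdigon (suc N) m) D∈
  (cong₂ _∧_ (nonCrossing⁺ D∈ nc) (sameTy⁺ (typeOf (suc N) D) m (λ k → trans (entry-typeOf N D k) (ty k))))

unique-subdigonsOn : ∀ N m → Unique (subdigonsOn (suc N) m)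
unique-subdigonsOn N m = unique-filterᵇ (isSubdigon (suc N) m) (unique-subs (unique-diagonals N))

-- With `X` trivial this gives the plain count, and with `X` the condition on the central polygon
-- the restricted one. The two lists in correspondence differ only in whether the roof is listed;
-- for `M = 1` it is a side and listed in neither.
module _ (X : (Seg → Bool) → ℕ → Set) (X-cong : ∀ {N E E′} → Agree N E E′ → X E N → X E′ N) where

  card-subdigons : ∀ m {n} → let N = 1 + weight 1 m in
    Card (λ D → Subdigon N m D × X (isEdge (suc N) D) N) n →
    Card (λ ((N , D) : Sys) → System 1 m (N , D) × X (edge D) N) n
  card-subdigons m = card-bijection R to from injective functional
    where
    M = 1 + weight 1 m
    R : List Seg → Sys → Set
    R D (N , D′) = N ≡ M × Agree M (isEdge (suc M) D) (edge D′)
    to : ∀ {D} → Subdigon M m D × X (isEdge (suc M) D) M →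
      ∃[ y ] (System 1 m y × X (edge (proj₂ y)) (proj₁ y)) × R D y
    to {D} (subdigon _ nc ty , x) with realise M (isEdge (suc M) D) (λ {i} _ → isEdge-side M D i)
    ... | D′ , D′∈ , ag = (M , D′)
      , (system D′∈ (nonCrossing-cong (agree-sym ag) nc) [ M ]
           (outer-roof z<s (trans (ag z<s ≤-refl) (isEdge-roof M D))) refl (hasType-cong {m = m} (agree-sym ag) ty)
        , X-cong (agree-sym ag) x)
      , refl , agree-sym ag
    from : ∀ {y} → System 1 m y × X (edge (proj₂ y)) (proj₁ y) →
      ∃[ D ] (Subdigon M m D × X (isEdge (suc M) D) M) × R D y
    -- The system brings its own `N`; Euler's relation identifies it with `M`.
    from {N , D′} (s , x) with system-size s
    ... | refl with realiseDiagonals M (edge D′) (edge-sides D′ M) (proj₂ (system₁-roof s))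
    ... | D , D∈ , ag = D
      , (subdigon D∈ (nonCrossing-cong (agree-sym ag) (System.noCrossing s)) (hasType-cong {m = m} (agree-sym ag) (System.hasType s))
        , X-cong (agree-sym ag) x)
      , refl , ag
    injective : ∀ D D′ y → Subdigon M m D × X (isEdge (suc M) D) M → Subdigon M m D′ × X (isEdge (suc M) D′) M →
      R D y → R D′ y → D ≡ D′
    injective _ _ _ (s , _) (s′ , _) (_ , ag) (_ , ag′) = isEdge-injective (Subdigon.diagonalSet s) (Subdigon.diagonalSet s′)
      (λ i<j j≤ → trans (ag i<j j≤) (sym (ag′ i<j j≤)))
    functional : ∀ D y y′ → System 1 m y × X (edge (proj₂ y)) (proj₁ y) → System 1 m y′ × X (edge (proj₂ y′)) (proj₁ y′) →
      R D y → R D y′ → y ≡ y′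
    functional _ _ _ (s , _) (s′ , _) (refl , ag) (refl , ag′) = cong (M ,_) (edge-injective (System.arcSet s) (System.arcSet s′)
      (λ i<j j≤ → trans (sym (ag i<j j≤)) (ag′ i<j j≤)))

card-system₁ : ∀ m → Card (System 1 m) (C m)
card-system₁ m = card-⇔ proj₁ (_, tt) (card-subdigons (λ _ _ → ⊤) (λ _ _ → tt) m
  (card (subdigonsOn (2 + weight 1 m) m) (unique-subdigonsOn (1 + weight 1 m) m) (λ D∈ → subdigonsOn⁻ {1 + weight 1 m} D∈ , tt) (subdigonsOn⁺ ∘ proj₁)
    (cong (λ V → length (subdigonsOn V m)) (sym (Vt≡weight m)))))

card-central : ∀ r m → Card (λ ((N , D) : Sys) → System 1 m (N , D) × Central r (edge D) N) (countCentral r m)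
card-central r m = card-subdigons (Central r) central-cong m
  (subst (Card _) (cong (λ V → length (filterᵇ (centralIs r V) (subdigonsOn V m))) (sym (Vt≡weight m)))
    (card-⇔ (λ {D} (D∈ , c) → subdigonsOn⁻ {1 + weight 1 m} D∈ , centralIs⁻ r _ D c) (λ {D} (s , c) → subdigonsOn⁺ s , centralIs⁺ r _ D c)
      (card-filterᵇ (centralIs r (2 + weight 1 m)) (unique-subdigonsOn (1 + weight 1 m) m))))

-- The bijection deleting the roof

module _ {E E′ N} (rf : Roof E E′ N) (nc : NonCrossing N E′) (0<N : 0 < N) {xs} (o : Outer E′ N 0 xs)
         {r} (2≤r : 2 ≤ r) (len : length xs ≡ r) (m : Ty) where

  private
    -- The one face lost with the roof has `suc r` vertices and accounts for the unit of `unitTy r`.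
    count-roof : ∀ k → countSize (3 + k) (facesOf E N) ≡ entry (unitTy r) k + countSize (3 + k) (facesOf E′ N)
    count-roof k = trans (countSize-↭ (3 + k) (roof-faces rf nc 0<N o)) (trans (countSize-∷ (3 + k) (0 ∷ xs) (facesOf E′ N))
      (cong (_+ countSize (3 + k) (facesOf E′ N)) (trans (cong (λ l → indicator (suc l ≡ᵇ 3 + k)) len) (sym (entry-unitTy r k 2≤r)))))

  hasType-roof⁻ : HasType (facesOf E N) (m ⊕ unitTy r) → HasType (facesOf E′ N) m
  hasType-roof⁻ ty k = +-cancelˡ-≡ (entry (unitTy r) k) _ _ (trans (sym (count-roof k)) (trans (ty k)
    (trans (entry-⊕ m (unitTy r) k) (+-comm (entry m k) _))))

  hasType-roof⁺ : HasType (facesOf E′ N) m → HasType (facesOf E N) (m ⊕ unitTy r)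
  hasType-roof⁺ ty k = trans (count-roof k) (trans (cong (entry (unitTy r) k +_) (ty k))
    (trans (+-comm _ (entry m k)) (sym (entry-⊕ m (unitTy r) k))))

addRoof : ℕ → (Seg → Bool) → Seg → Bool
addRoof N E p = E p ∨ eqSeg p (0 , N)

addRoof-roof : ∀ {N E} → ¬ E ∋ (0 , N) → Roof (addRoof N E) E N
addRoof-roof {N} {E} ¬e = roof same (∨-trueʳ (E (0 , N)) (T⇒≡ (eqSeg-refl (0 , N)))) ¬e
  where
  same : ∀ {i j} → i < j → j ≤ N → (i , j) ≢ (0 , N) → addRoof N E (i , j) ≡ E (i , j)
  same {i} {j} _ _ ≢ with eqSeg (i , j) (0 , N) in eq
  ... | true = ⊥-elim (≢ (eqSeg⇒≡ (≡⇒T eq)))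
  ... | false = ∨-identityʳ _

roof-congˡ : ∀ {N E₁ E₂ E′} → 0 < N → Agree N E₁ E₂ → Roof E₁ E′ N → Roof E₂ E′ N
roof-congˡ 0<N ag (roof same p a) = roof (λ i<j j≤ ≢ → trans (sym (ag i<j j≤)) (same i<j j≤ ≢)) (trans (sym (ag 0<N ≤-refl)) p) a

roof-congʳ : ∀ {N E E₁ E₂} → 0 < N → Agree N E₁ E₂ → Roof E E₁ N → Roof E E₂ N
roof-congʳ 0<N ag (roof same p a) = roof (λ i<j j≤ ≢ → trans (same i<j j≤ ≢) (ag i<j j≤)) p (a ∘ trans (ag 0<N ≤-refl))

roof-injective : ∀ {N E₁ E₂ E′} → Roof E₁ E′ N → Roof E₂ E′ N → Agree N E₁ E₂
roof-injective {N} (roof s₁ p₁ _) (roof s₂ p₂ _) {i} {j} i<j j≤ with i ≟ 0 | j ≟ N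
... | yes refl | yes refl = trans p₁ (sym p₂)
... | no i≢ | _ = trans (s₁ i<j j≤ (i≢ ∘ cong proj₁)) (sym (s₂ i<j j≤ (i≢ ∘ cong proj₁)))
... | yes _ | no j≢ = trans (s₁ i<j j≤ (j≢ ∘ cong proj₂)) (sym (s₂ i<j j≤ (j≢ ∘ cong proj₂)))

roof-functional : ∀ {N E E₁ E₂} → Roof E E₁ N → Roof E E₂ N → Agree N E₁ E₂
roof-functional {N} (roof s₁ _ a₁) (roof s₂ _ a₂) {i} {j} i<j j≤ with i ≟ 0 | j ≟ N
... | yes refl | yes refl = trans (¬-not a₁) (sym (¬-not a₂))
... | no i≢ | _ = trans (sym (s₁ i<j j≤ (i≢ ∘ cong proj₁))) (s₂ i<j j≤ (i≢ ∘ cong proj₁))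
... | yes _ | no j≢ = trans (sym (s₁ i<j j≤ (j≢ ∘ cong proj₂))) (s₂ i<j j≤ (j≢ ∘ cong proj₂))

card-dropRoof : ∀ {r m n} → 2 ≤ r →
  Card (λ ((N , D) : Sys) → System 1 (m ⊕ unitTy r) (N , D) × Central r (edge D) N) n → Card (System r m) n
card-dropRoof {r} {m} 2≤r = card-bijection R to from injective functional
  where
  P : Sys → Set
  P (N , D) = System 1 (m ⊕ unitTy r) (N , D) × Central r (edge D) N
  R : Sys → Sys → Set
  R (N , D) (N′ , D′) = N ≡ N′ × Roof (edge D) (edge D′) N
  to : ∀ {x} → P x → ∃[ y ] System r m y × R x y
  to {zero , D} (s , _) = ⊥-elim (n≮0 (proj₁ (system₁-roof s)))
  -- Two vertices carry no face, hence no central polygon.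
  to {suc zero , D} (_ , S , () , _)
  to {N@(suc (suc _)) , D} (s , S , S∈ , 0∈ , N∈ , len) = (N , D′)
    , system D′∈ nc′ xs o len′ (hasType-roof⁻ rf nc′ z<s o 2≤r len′ m (System.hasType s))
    , refl , rf
    where
    rf₀ = dropRoof-roof {N} {edge D} (proj₂ (system₁-roof s))
    realised = realise N (dropRoof N (edge D)) (roof-sides (s≤s (s≤s z≤n)) rf₀ (edge-sides D N))
    D′ = proj₁ realised
    D′∈ = proj₁ (proj₂ realised)
    rf = roof-congʳ z<s (agree-sym (proj₂ (proj₂ realised))) rf₀
    nc′ = proj₁ (roof-nonCrossing rf) (System.noCrossing s)
    xs = proj₁ (outer-exists {edge D′} {N} (edge-sides D′ N) z≤n)
    o = proj₂ (outer-exists {edge D′} {N} (edge-sides D′ N) z≤n)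
    len′ : length xs ≡ r
    len′ = suc-injective (trans (sym (cong length (central-unique rf nc′ z<s o S∈ 0∈ N∈))) len)
  from : ∀ {y} → System r m y → ∃[ x ] P x × R x y
  from (system _ _ _ done refl _) = ⊥-elim (n≮0 2≤r)
  -- A one-step path is already the roof, so none could be added; `2 ≤ r` excludes this.
  from (system _ _ _ (step _ _ _ _ done) refl _) = ⊥-elim (<-irrefl refl 2≤r)
  from {N , D′} (system D′∈ nc′ xs@(s ∷ t ∷ _) o@(step 0<s s≤N _ mx (step s<t t≤N _ _ _)) len ty) = (N , D)
    , (system D∈ (proj₂ (roof-nonCrossing rf) nc′) [ N ] (outer-roof 0<N (Roof.present rf)) refl
         (hasType-roof⁺ rf nc′ 0<N o 2≤r len m ty)
      , 0 ∷ xs , central∈ rf nc′ 0<N o , here refl , subst (_∈ 0 ∷ xs) (outer-final o) (final∈ 0 xs) , cong suc len)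
    , refl , rf
    where
    0<N = <-≤-trans 0<s s≤N
    -- The path continues past `s`, so `s < N`, and maximality of the first step shows that the roof
    -- is absent.
    rf₀ = addRoof-roof {N} {edge D′} (mx (<-≤-trans s<t t≤N) ≤-refl)
    realised = realise N (addRoof N (edge D′)) (λ {i} _ → cong (_∨ eqSeg (i , suc i) (0 , N)) (edge-side D′ i))
    D = proj₁ realised
    D∈ = proj₁ (proj₂ realised)
    rf = roof-congˡ 0<N (agree-sym (proj₂ (proj₂ realised))) rf₀
  injective : ∀ x x′ y → P x → P x′ → R x y → R x′ y → x ≡ x′
  injective _ _ _ (s , _) (s′ , _) (refl , rf) (refl , rf′) =
    cong (_ ,_) (edge-injective (System.arcSet s) (System.arcSet s′) (roof-injective rf rf′))
  functional : ∀ x y y′ → System r m y → System r m y′ → R x y → R x y′ → y ≡ y′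
  functional _ _ _ s s′ (refl , rf) (refl , rf′) =
    cong (_ ,_) (edge-injective (System.arcSet s) (System.arcSet s′) (roof-functional rf rf′))

-- Cutting off the first tree of a system

-- The value `false` falls on the pairs passing over `s`, which is the `gap` demanded by `Split`.
glue : ℕ → (Seg → Bool) → (Seg → Bool) → Seg → Bool
glue s E₁ E₂ (i , j) with j ≤? s | s ≤? i
... | yes _ | _     = E₁ (i , j)
... | no _  | yes _ = E₂ (i ∸ s , j ∸ s)
... | no _  | no _  = false

glue-split : ∀ s n E₁ E₂ → Split (glue s E₁ E₂) E₁ E₂ s n
glue-split s n E₁ E₂ = split left right gap
  where
  left : Agree s (glue s E₁ E₂) E₁
  left {i} {j} _ j≤s with j ≤? s | s ≤? i
  ... | yes _ | _ = refl
  ... | no j≰s | _ = ⊥-elim (j≰s j≤s)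
  right : Agree n (glue s E₁ E₂ ∘ shift s) E₂
  right {i} {j} i<j _ with s + j ≤? s | s ≤? s + i
  ... | yes ≤s | _ = ⊥-elim (<⇒≱ (m<m+n s (≤-<-trans z≤n i<j)) ≤s)
  ... | no _ | no ≰ = ⊥-elim (≰ (m≤m+n s i))
  ... | no _ | yes _ = cong₂ (λ a b → E₂ (a , b)) (m+n∸m≡n s i) (m+n∸m≡n s j)
  gap : ∀ {i j} → i < s → s < j → j ≤ s + n → ¬ glue s E₁ E₂ ∋ (i , j)
  gap {i} {j} i<s s<j _ with j ≤? s | s ≤? i
  ... | yes j≤s | _ = ⊥-elim (<⇒≱ s<j j≤s)
  ... | no _ | yes s≤i = ⊥-elim (<⇒≱ i<s s≤i)
  ... | no _ | no _ = λ ()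

split-sides : ∀ {E E₁ E₂ s n} → Split E E₁ E₂ s n → Sides s E₁ → Sides n E₂ → Sides (s + n) E
split-sides {E} {s = s} (split left right _) sd₁ sd₂ {i} i<N with i <? s
... | yes i<s = trans (left ≤-refl i<s) (sd₁ i<s)
... | no i≮s with m≤n⇒∃[o]m+o≡n (≮⇒≥ i≮s)
... | k , refl = subst (λ j → E ∋ (s + k , j)) (+-suc s k) (trans (right ≤-refl k<n) (sd₂ k<n))
  where k<n = +-cancelˡ-< s _ _ i<N

split-congˡ : ∀ {E E′ E₁ E₂ s n} → Agree (s + n) E E′ → Split E E₁ E₂ s n → Split E′ E₁ E₂ s n
split-congˡ {s = s} {n} ag (split left right gap) = split
  (λ i<j j≤s → trans (sym (ag i<j (≤-trans j≤s (m≤m+n s n)))) (left i<j j≤s))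
  (λ i<j j≤n → trans (sym (ag (+-monoʳ-< s i<j) (+-monoʳ-≤ s j≤n))) (right i<j j≤n))
  (λ i<s s<j j≤N e → gap i<s s<j j≤N (trans (ag (<-trans i<s s<j) j≤N) e))

split-injective : ∀ {E E′ E₁ E₂ s n} → Split E E₁ E₂ s n → Split E′ E₁ E₂ s n → Agree (s + n) E E′
split-injective {s = s} (split l r g) (split l′ r′ g′) {i} {j} i<j j≤N with j ≤? s | i <? s
... | yes j≤s | _ = trans (l i<j j≤s) (sym (l′ i<j j≤s))
... | no j≰s | yes i<s = trans (¬-not (g i<s (≰⇒> j≰s) j≤N)) (sym (¬-not (g′ i<s (≰⇒> j≰s) j≤N)))
... | no j≰s | no i≮s with m≤n⇒∃[o]m+o≡n (≮⇒≥ i≮s) | m≤n⇒∃[o]m+o≡n (<⇒≤ (≰⇒> j≰s))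
... | i′ , refl | j′ , refl = trans (r i<j′ j≤n) (sym (r′ i<j′ j≤n))
  where
  i<j′ = +-cancelˡ-< s _ _ i<j
  j≤n = +-cancelˡ-≤ s _ _ j≤N

split-count : ∀ {E E₁ E₂ s n} → Split E E₁ E₂ s n → ∀ k →
  countSize k (facesOf E (s + n)) ≡ countSize k (facesOf E₁ s) + countSize k (facesOf E₂ n)
split-count {E} {E₁} {E₂} {s} {n} sp k = trans (countSize-↭ k (split-faces sp)) (trans (countSize-++ k (facesOf E₁ s) _)
  (cong (countSize k (facesOf E₁ s) +_) (countSize-shift k s (facesOf E₂ n))))

-- The type `l` of the left part is a component of the triple so that triples match the sum over
-- `below m` in `coeffSPow`. The left part determines `l` because all members of `below m` have the
-- same length.
card-cut : ∀ {r m n} →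
  Card (λ ((l , x , y) : Ty × Sys × Sys) → l ∈ below m × System 1 l x × System r (zipWith _∸_ m l) y) n →
  Card (System (suc r) m) n
card-cut {r} {m} = card-bijection R to from injective functional
  where
  P : Ty × Sys × Sys → Set
  P (l , x , y) = l ∈ below m × System 1 l x × System r (zipWith _∸_ m l) y
  R : Ty × Sys × Sys → Sys → Set
  R (l , (s , D₁) , (n , D₂)) (N , D) = N ≡ s + n × Split (edge D) (edge D₁) (edge D₂) s n
  to : ∀ {z} → P z → ∃[ x ] System (suc r) m x × R z x
  to {l , (s , D₁) , (n , D₂)} (l∈ , s₁@(system _ nc₁ (_ ∷ []) o₁@(step 0<s _ _ _ done) _ ty₁) , system _ nc₂ xs o₂ len ty₂) =
    (s + n , D) , system D∈ (split-nonCrossing⁺ sp nc₁ nc₂) (s ∷ map (s +_) xs) (outer-split⁺ sp 0<s o₁ o₂)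
                    (cong suc (trans (length-map (s +_) xs) len)) ty
                , refl , sp
    where
    realised = realise (s + n) (glue s (edge D₁) (edge D₂))
      (split-sides (glue-split s n (edge D₁) (edge D₂)) (edge-sides D₁ s) (edge-sides D₂ n))
    D = proj₁ realised
    D∈ = proj₁ (proj₂ realised)
    sp = split-congˡ (agree-sym (proj₂ (proj₂ realised))) (glue-split s n (edge D₁) (edge D₂))
    ty : HasType (facesOf (edge D) (s + n)) m
    ty k = let len , le = below⁻ m l∈ in
      trans (split-count sp (3 + k)) (trans (cong₂ _+_ (ty₁ k) (trans (ty₂ k) (entry-zipWith-∸ m l k len))) (m+[n∸m]≡n (le k)))
  from : ∀ {x} → System (suc r) m x → ∃[ z ] P z × R z x
  from {N , D} (system D∈ nc (s ∷ xs) o@(step 0<s s≤N _ _ _) len ty) with m≤n⇒∃[o]m+o≡n s≤N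
  ... | n , refl with realise s (edge D) (edge-sides D s)
                    | realise n (edge D ∘ shift s) (λ {i} _ → subst (λ j → edge D ∋ (s + i , j)) (sym (+-suc s i)) (edge-side D (s + i)))
  ... | D₁ , D₁∈ , ag₁ | D₂ , D₂∈ , ag₂ = cut (outer-split⁻ sp o)
    where
    sp : Split (edge D) (edge D₁) (edge D₂) s n
    sp = split (agree-sym ag₁) (agree-sym ag₂) (outer-gap nc o)
    f : ℕ → ℕ
    f k = countSize (3 + k) (facesOf (edge D₁) s)
    total : ∀ k → f k + countSize (3 + k) (facesOf (edge D₂) n) ≡ entry m k
    total k = trans (sym (split-count sp (3 + k))) (ty k)
    f≤ : ∀ k → f k ≤ entry m k
    f≤ k = subst (f k ≤_) (total k) (m≤m+n (f k) _)
    l : Ty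
    l = restrict m f
    entry-l : ∀ k → entry l k ≡ f k
    entry-l = entry-restrict m f f≤
    ty₂ : HasType (facesOf (edge D₂) n) (zipWith _∸_ m l)
    ty₂ k = sym (trans (entry-zipWith-∸ m l k (length-restrict m f))
      (trans (cong₂ _∸_ (sym (total k)) (entry-l k)) (m+n∸m≡n (f k) _)))
    ncs = split-nonCrossing⁻ sp nc
    cut : Outer (edge D₁) s 0 [ s ] × ∃[ ys ] xs ≡ map (s +_) ys × Outer (edge D₂) n 0 ys → ∃[ z ] P z × R z (s + n , D)
    cut (o₁ , ys , refl , o₂) = (l , (s , D₁) , (n , D₂))
      , (below⁺ m (length-restrict m f) (λ k → subst (_≤ entry m k) (sym (entry-l k)) (f≤ k))
        , system D₁∈ (proj₁ ncs) [ s ] o₁ refl (λ k → sym (entry-l k))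
        , system D₂∈ (proj₂ ncs) ys o₂ (trans (sym (length-map (s +_) ys)) (suc-injective len)) ty₂)
      , refl , sp
  -- The cut vertex is the largest neighbour of 0.
  same-cut : ∀ {E E₁ E₂ E₁′ E₂′ s n s′ n′} → s + n ≡ s′ + n′ → Split E E₁ E₂ s n → Split E E₁′ E₂′ s′ n′ →
    0 < s → 0 < s′ → E₁ ∋ (0 , s) → E₁′ ∋ (0 , s′) → s ≡ s′
  same-cut {s = s} {n} {s′} {n′} eq sp sp′ 0<s 0<s′ e e′ with <-cmp s s′
  ... | tri≈ _ s≡s′ _ = s≡s′
  ... | tri< s<s′ _ _ = ⊥-elim (Split.gap sp 0<s s<s′ (subst (s′ ≤_) (sym eq) (m≤m+n s′ n′)) (trans (Split.left sp′ 0<s′ ≤-refl) e′))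
  ... | tri> _ _ s′<s = ⊥-elim (Split.gap sp′ 0<s′ s′<s (subst (s ≤_) eq (m≤m+n s n)) (trans (Split.left sp 0<s ≤-refl) e))
  functional : ∀ z x x′ → System (suc r) m x → System (suc r) m x′ → R z x → R z x′ → x ≡ x′
  functional _ _ _ s s′ (refl , sp) (refl , sp′) = cong (_ ,_) (edge-injective (System.arcSet s) (System.arcSet s′) (split-injective sp sp′))
  injective : ∀ z z′ x → P z → P z′ → R z x → R z′ x → z ≡ z′
  injective (l , (s , D₁) , (n , D₂)) (l′ , (s′ , D₁′) , (n′ , D₂′)) _ (l∈ , s₁ , s₂) (l′∈ , s₁′ , s₂′) (refl , sp) (eq , sp′)
    with system₁-roof s₁ | system₁-roof s₁′
  ... | 0<s , e | 0<s′ , e′ with same-cut eq sp sp′ 0<s 0<s′ e e′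
  ... | refl with +-cancelˡ-≡ s n n′ eq
  ... | refl with edge-injective (System.arcSet s₁) (System.arcSet s₁′)
                    (λ i<j j≤ → trans (sym (Split.left sp i<j j≤)) (Split.left sp′ i<j j≤))
                | edge-injective (System.arcSet s₂) (System.arcSet s₂′)
                    (λ i<j j≤ → trans (sym (Split.right sp i<j j≤)) (Split.right sp′ i<j j≤))
  ... | refl | refl = cong (_, (s , D₁) , (n , D₂)) (sameLength-entries l l′
    (trans (proj₁ (below⁻ m l∈)) (sym (proj₁ (below⁻ m l′∈))))
    (λ k → trans (sym (System.hasType s₁ k)) (System.hasType s₁′ k)))

-- Systems are counted by the powers of the series

card-system₀ : ∀ m → Card (System 0 m) (if isZeroTy m then 1 else 0)
card-system₀ m with isZeroTy m in eq
... | true = card [ (0 , []) ] ([] ∷ [])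
    (λ { (here refl) → system (here refl) (λ { _ _ () z≤n }) [] done refl (λ k → sym (isZeroTy⁻ m eq k)) })
    (λ { (system (here refl) _ [] done _ _) → here refl }) refl
... | false = card [] [] (λ ()) nonzero refl
  where
  nonzero : ∀ {x} → System 0 m x → x ∈ []
  nonzero (system _ _ [] done _ ty) with trans (sym eq) (isZeroTy⁺ m (λ k → sym (ty k)))
  ... | ()

-- The successor clause of `coeffSPow` is read as a disjoint union, over the type of the left part,
-- of products.
card-system : ∀ r m → Card (System r m) (coeffSPow r m)
card-system zero m = card-system₀ m
card-system (suc r) m = card-cut (card-Σ _ (below m) (unique-below m)
  (λ {l} _ → card-× (card-system₁ l) (card-system r (zipWith _∸_ m l))))

theorem6 : (r : ℕ) → 2 ≤ r → (m : Ty) →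
    coeffSPow r m ≡ countCentral r (m ⊕ unitTy r)
theorem6 r 2≤r m = card-functional (card-system r m) (card-dropRoof 2≤r (card-central r (m ⊕ unitTy r)))
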